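{- Let $\ell\ge 5$ be a prime number, $N>0$ an integer prime to $\ell$, and $k>2$ an integer. Let $f\in S_{k}(\Gamma_{1}(N))$ be a normalized eigenform with nebentypus character $\varepsilon$ and let $\lambda$ be a prime of $K_f$ lying over $\ell$. Suppose the representation $\rho_{f,\ell}=\rho_{f,\lambda}$ is irreducible. Let $i$ be an integer with $0\le i \le \ell-1$ such that, with $$H=\{x \bmod N\ell \ :\ 0<x<N\ell,\ \gcd(x,N\ell)=1,\ \varepsilon(x)\,x^{k-2-2i} \equiv 1 \bmod \lambda \}\subseteq (\mathbb{Z}/N\ell\mathbb{Z})^{*},\qquad \Gamma_H=\Gamma_H(N\ell),$$ there exist a normalized eigenform $f_2\in S_2(\Gamma_H)$ and a prime $\lambda_2$ of $K_{f_2}$ over $\ell$ with $\rho_{f,\lambda}\cong\rho_{f_2,\lambda_2}\otimes\chi_\ell^i$. Suppose $\ell \nmid \phi(N)$ and $\ell-1$ divides $k-2-2i$. Then $\Gamma_H=\Gamma_{0}(N\ell)$ if and only if $f\in S_{k}(\Gamma_{0}(N))$.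
   Context: $\phi$ is Euler's totient function. For a positive integer $n$ and a subgroup $H$ of $(\mathbb{Z}/n\mathbb{Z})^{*}$, $\Gamma_H(n)$ is the group of matrices $\begin{pmatrix} a&b\\c&d\end{pmatrix}\in SL(2,\mathbb{Z})$ with $c\equiv 0 \pmod n$ and $d \bmod n\in H$; $\Gamma_0(n)$ and $\Gamma_1(n)$ are the cases $H=(\mathbb{Z}/n\mathbb{Z})^*$ and $H=\{1\}$. $S_k(\Gamma)$ is the space of cusp forms of weight $k$ on $\Gamma$. A normalized eigenform $g=\sum_{m>0}a_m(g)q^m$ is an eigenform for the Hecke operators (including diamond operators) with $a_1(g)=1$; $K_g$ is the number field generated by all the coefficients $a_m(g)$. For a normalized eigenform $g\in S_k(\Gamma_1(n))$ with nebentypus $\varepsilon$ and a prime $\mu$ of $K_g$ over $\ell$, with residue field embedded in $\overline{\mathbb{F}}_\ell$, $\rho_{g,\mu}:\mathrm{Gal}(\overline{\mathbb{Q}}/\mathbb{Q})\to GL_2(\overline{\mathbb{F}}_\ell)$ is the unique (up to isomorphism) continuous semisimple representation, unramified outside $n\ell$, such that for all primes $p\nmid n\ell$ the characteristic polynomial of $\rho_{g,\mu}(\mathrm{Frob}_p)$ is $x^2-a_p(g)x+\varepsilon(p)p^{k-1} \bmod \mu$; isomorphisms between representations attached to different forms are understood for suitable embeddings of residue fields. $\chi_\ell$ is the mod $\ell$ cyclotomic character. Negative powers of $x$ are taken modulo $\ell$. -}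

module Defs where

open import Algebra.Apartness.Bundles using (HeytingField; module HeytingCommutativeRing)
open import Algebra.Bundles using (RawRing; module CommutativeRing)
import Algebra.Definitions.RawSemiring as RawSemiringDefinitions
open import Data.Fin.Base using (Fin; toℕ)
open import Data.Integer.Base as ℤ using (ℤ; +_; -[1+_])
import Data.Integer.Coprimality as ℤ
open import Data.Integer.Divisibility.Signed using () renaming (_∣_ to _∣ℤ_)
open import Data.List.Base using (length; filter; applyUpTo)
open import Data.List.Relation.Unary.All using (All)
open import Data.Nat.Base as ℕ using (ℕ; suc; _∸_; _!)
open import Data.Nat.Coprimality using (Coprime; coprime?)
open import Data.Nat.Divisibility using (_∣_)
open import Data.Nat.Primality using (Prime)
open import Data.Product.Base using (_×_; _,_; ∃; ∃-syntax; Σ-syntax; proj₁)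
open import Data.Sum.Base using (_⊎_)
open import Function.Bundles using (_⇔_)
open import Level using (0ℓ)
open import Relation.Binary.Core using (Rel)
open import Relation.Binary.Definitions using (tri<; tri≈; tri>)
open import Relation.Binary.PropositionalEquality.Core using (_≡_)
open import Relation.Binary.Structures using (IsStrictTotalOrder)
open import Relation.Nullary.Negation using (¬_)
open import Relation.Unary using (Pred; _∈_; _∩_; _⊆_; ｛_｝)

φ : ℕ → ℕ
φ n = length (filter (λ x → coprime? x n) (applyUpTo suc n))

infix 4 _≡_[mod_]

_≡_[mod_] : ℤ → ℤ → ℕ → Set
x ≡ y [mod m ] = (+ m) ∣ℤ (x ℤ.- y)

-- PowerMod ℓ x e y says that y represents x^e modulo ℓ, where negative
-- powers of x (prime to ℓ) are powers of its inverse modulo ℓ.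
PowerMod : ℕ → ℤ → ℤ → ℤ → Set
PowerMod ℓ x (+ m)    y = y ≡ x ℤ.^ m [mod ℓ ]
PowerMod ℓ x -[1+ m ] y = (x ℤ.^ suc m) ℤ.* y ≡ + 1 [mod ℓ ]

record M₂ (A : Set) : Set where
  constructor mat
  field a b c d : A

module RingOperations (R : RawRing 0ℓ 0ℓ) where
  open RawRing R
  open RawSemiringDefinitions rawSemiring public
    using (_^_; sum) renaming (_×_ to _·_)

  infixl 6 _-_
  _-_ : Carrier → Carrier → Carrier
  x - y = x + (- y)

  fromℤ : ℤ → Carrier
  fromℤ (+ n)    = n · 1#
  fromℤ -[1+ n ] = - (suc n · 1#)

  fromℕ : ℕ → Carrier
  fromℕ n = fromℤ (+ n)

  Σ< : ℕ → (ℕ → Carrier) → Carrier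
  Σ< n t = sum {n} (λ j → t (toℕ j))

  eval : ∀ {n} → (Fin n → Carrier) → Carrier → Carrier
  eval {n} coeff x = sum {n} (λ j → coeff j * x ^ toℕ j)

  det : M₂ Carrier → Carrier
  det (mat a b c d) = a * d - b * c

  infix 4 _≈ₘ_
  _≈ₘ_ : M₂ Carrier → M₂ Carrier → Set
  mat a b c d ≈ₘ mat a′ b′ c′ d′ =
    (a ≈ a′) × (b ≈ b′) × (c ≈ c′) × (d ≈ d′)

  infixl 7 _*ₘ_ _*ₛ_
  _*ₘ_ : M₂ Carrier → M₂ Carrier → M₂ Carrier
  mat a b c d *ₘ mat a′ b′ c′ d′ =
    mat (a * a′ + b * c′) (a * b′ + b * d′)
        (c * a′ + d * c′) (c * b′ + d * d′)

  _*ₛ_ : Carrier → M₂ Carrier → M₂ Carrier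
  x *ₛ mat a b c d = mat (x * a) (x * b) (x * c) (x * d)

  1ₘ : M₂ Carrier
  1ₘ = mat 1# 0# 0# 1#

  -- Value at t of the characteristic polynomial det (t·1 − M).
  charPoly : M₂ Carrier → Carrier → Carrier
  charPoly (mat a b c d) t = det (mat (t - a) (- b) (- c) (t - d))

open RingOperations ℤ.+-*-rawRing using () renaming (det to detℤ)

SL₂ℤ : Pred (M₂ ℤ) 0ℓ
SL₂ℤ γ = detℤ γ ≡ + 1

-- H is given by a set of natural numbers representing its elements
-- modulo n.
Γ : (n : ℕ) (H : Pred ℕ 0ℓ) → Pred (M₂ ℤ) 0ℓ
Γ n H γ = SL₂ℤ γ × M₂.c γ ≡ + 0 [mod n ] × ∃[ x ] H x × M₂.d γ ≡ + x [mod n ]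

Γ₀ Γ₁ : ℕ → Pred (M₂ ℤ) 0ℓ
Γ₀ n = Γ n (λ x → Coprime x n)
Γ₁ n = Γ n ｛ 1 ｝

-- The real numbers as a Dedekind-complete ordered field, which classically
-- is unique up to isomorphism. The law <⇒# together with trichotomy makes
-- the apartness of the Heyting field coincide with inequality.
record RealField : Set₁ where
  field
    heytingField : HeytingField 0ℓ 0ℓ 0ℓ
  open HeytingField heytingField public

  infix 4 _<_ _≤_
  field
    _<_                : Rel Carrier 0ℓ
    isStrictTotalOrder : IsStrictTotalOrder _≈_ _<_
    <⇒#                : ∀ {x y} → x < y → x # y
    +-monoˡ-<          : ∀ z {x y} → x < y → (x + z) < (y + z)
    *-pos              : ∀ {x y} → 0# < x → 0# < y → 0# < (x * y)

  _≤_ : Rel Carrier 0ℓ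
  x ≤ y = ¬ (y < x)

  UpperBound : Pred Carrier 0ℓ → Pred Carrier 0ℓ
  UpperBound P u = ∀ x → P x → x ≤ u

  field
    supremum : (P : Pred Carrier 0ℓ) → ∃ P → ∃ (UpperBound P) →
               ∃[ s ] UpperBound P s × (∀ u → UpperBound P u → s ≤ u)

  open IsStrictTotalOrder isStrictTotalOrder public using (compare)

  -- Total inverse, with 0⁻¹ = 0.
  infix 9 _⁻¹
  _⁻¹ : Carrier → Carrier
  x ⁻¹ with compare x 0#
  ... | tri< x<0 _ _ = proj₁ (#⇒invertible (<⇒# x<0))
  ... | tri≈ _ _ _   = 0#
  ... | tri> _ _ 0<x = - proj₁ (#⇒invertible (<⇒# 0<x))

module Complex (ℝ : RealField) where
  private module ℝ = RealField ℝ
  open ℝ using (_<_; _≤_)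

  infix 5 _+i_
  record ℂ : Set where
    constructor _+i_
    field re im : ℝ.Carrier

  infix 4 _≈ᶜ_
  record _≈ᶜ_ (z w : ℂ) : Set where
    constructor _,_
    field
      re : ℂ.re z ℝ.≈ ℂ.re w
      im : ℂ.im z ℝ.≈ ℂ.im w

  ℂ-rawRing : RawRing 0ℓ 0ℓ
  ℂ-rawRing = record
    { Carrier = ℂ
    ; _≈_ = _≈ᶜ_
    ; _+_ = λ (x +i y) (x′ +i y′) → (x ℝ.+ x′) +i (y ℝ.+ y′)
    ; _*_ = λ (x +i y) (x′ +i y′) →
        ((x ℝ.* x′) ℝ.- (y ℝ.* y′)) +i ((x ℝ.* y′) ℝ.+ (y ℝ.* x′))
    ; -_  = λ (x +i y) → (ℝ.- x) +i (ℝ.- y)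
    ; 0#  = ℝ.0# +i ℝ.0#
    ; 1#  = ℝ.1# +i ℝ.0#
    }

  open RawRing ℂ-rawRing public using (_≈_; _+_; _*_; -_; 0#; 1#)
  open RingOperations ℂ-rawRing public
    using (_-_; _^_; fromℤ; fromℕ; Σ<; eval)

  ∣_∣² : ℂ → ℝ.Carrier
  ∣ x +i y ∣² = (x ℝ.* x) ℝ.+ (y ℝ.* y)

  infix 9 _⁻¹
  _⁻¹ : ℂ → ℂ
  (x +i y) ⁻¹ = (x ℝ.* r) +i (ℝ.- (y ℝ.* r))
    where r = ∣ x +i y ∣² ℝ.⁻¹

  ℍ : Pred ℂ 0ℓ
  ℍ z = ℝ.0# < ℂ.im z

  -- Estimates are stated for squared absolute values.
  HasSum : (ℕ → ℂ) → ℂ → Set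
  HasSum t s = ∀ δ → ℝ.0# < δ →
    ∃[ m ] ∀ n → m ℕ.≤ n → ∣ Σ< n t - s ∣² < δ

  IsExp : ℂ → ℂ → Set
  IsExp z w = HasSum (λ n → fromℕ (n !) ⁻¹ * z ^ n) w

  -- 2π is the least y > 0 with exp (iy) = 1.
  IsTwoPi : ℝ.Carrier → Set
  IsTwoPi τ = ℝ.0# < τ × IsExp (ℝ.0# +i τ) 1# ×
    (∀ y → ℝ.0# < y → IsExp (ℝ.0# +i y) 1# → τ ≤ y)

  DifferentiableAt : (ℂ → ℂ) → ℂ → Set
  DifferentiableAt f z = ∃[ f′ ] ∀ e → ℝ.0# < e → ∃[ δ ] ℝ.0# < δ ×
    (∀ w → w ∈ ℍ → ∣ w - z ∣² < δ →
      ∣ f w - f z - f′ * (w - z) ∣² ≤ (e ℝ.* ∣ w - z ∣²))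

-- A function on the upper half-plane is represented by a function on ℂ, of
-- which only the values on ℍ are ever constrained.
module ModularForms (ℝ : RealField) where
  open Complex ℝ public
  private module ℝ = RealField ℝ
  open ℝ using (_<_)

  infix 4 _≈ℍ_
  _≈ℍ_ : (ℂ → ℂ) → (ℂ → ℂ) → Set
  f ≈ℍ g = ∀ z → z ∈ ℍ → f z ≈ g z

  -- det(α)^(k−1) (cz+d)^(−k) f((az+b)/(cz+d))
  infixl 8 _∣[_]_
  _∣[_]_ : (ℂ → ℂ) → ℕ → M₂ ℤ → ℂ → ℂ
  (f ∣[ k ] α@(mat a b c d)) z =
    fromℤ (detℤ α) ^ (k ∸ 1) * (j ⁻¹) ^ k * f ((fromℤ a * z + fromℤ b) * j ⁻¹)
    where j = fromℤ c * z + fromℤ d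

  VanishesAt∞ : (ℂ → ℂ) → Set
  VanishesAt∞ f = ∀ δ → ℝ.0# < δ →
    ∃[ B ] ∀ z → z ∈ ℍ → B < ℂ.im z → ∣ f z ∣² < δ

  -- f ∈ S_k(G); the cusps are the SL(2,ℤ)-translates of ∞.
  record IsCuspForm (k : ℕ) (G : Pred (M₂ ℤ) 0ℓ) (f : ℂ → ℂ) : Set where
    field
      cong        : ∀ {z w} → z ∈ ℍ → z ≈ w → f z ≈ f w
      holomorphic : ∀ z → z ∈ ℍ → DifferentiableAt f z
      invariant   : ∀ γ → γ ∈ G → f ∣[ k ] γ ≈ℍ f
      cuspidal    : ∀ γ → γ ∈ SL₂ℤ → VanishesAt∞ (f ∣[ k ] γ)

  record IsDirichletCharacter (n : ℕ) (ε : ℤ → ℂ) : Set where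
    field
      periodic : ∀ x y → x ≡ y [mod n ] → ε x ≈ ε y
      *-homo   : ∀ x y → ε (x ℤ.* y) ≈ ε x * ε y
      1-homo   : ε (+ 1) ≈ 1#
      vanishes : ∀ x → ¬ ℤ.Coprime x (+ n) → ε x ≈ 0#

  -- Σ_{b<p} f ∣ (1 b; 0 p) = (1/p) Σ_{b<p} f((z+b)/p)
  U : (k p : ℕ) → (ℂ → ℂ) → ℂ → ℂ
  U k p f z = Σ< p (λ b → (f ∣[ k ] mat (+ 1) (+ b) (+ 0) (+ p)) z)

  -- The operator T_p on weight k and level n: for p ∣ n it is U_p, and for
  -- p ∤ n it is f ↦ U_p f + (⟨p⟩f) ∣ (p 0; 0 1), where ⟨d⟩f is f ∣ γ for any
  -- γ ∈ Γ₀(n) with lower right entry congruent to d modulo n.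
  IsHeckeEigenvalue : (k n p : ℕ) → (ℂ → ℂ) → ℂ → Set
  IsHeckeEigenvalue k n p f e =
    (p ∣ n → U k p f ≈ℍ (λ z → e * f z)) ×
    (¬ p ∣ n → ∀ γ → γ ∈ Γ₀ n → M₂.d γ ≡ + p [mod n ] →
      (λ z → U k p f z + (f ∣[ k ] γ ∣[ k ] mat (+ p) (+ 0) (+ 0) (+ 1)) z)
        ≈ℍ (λ z → e * f z))

  HasQExpansion : (ℂ → ℂ) → (ℕ → ℂ) → Set
  HasQExpansion f a = ∃[ τ ] IsTwoPi τ × (∀ z → z ∈ ℍ →
    ∃[ q ] IsExp ((ℝ.0# +i τ) * z) q × HasSum (λ m → a m * q ^ m) (f z))

  -- The operators T_p and ⟨d⟩ generate the Hecke algebra; ε is the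
  -- nebentypus.
  record NormalizedEigenform (k n : ℕ) : Set where
    field
      form        : ℂ → ℂ
      ε           : ℤ → ℂ
      coeff       : ℕ → ℂ
      cuspForm    : IsCuspForm k (Γ₁ n) form
      nonzero     : ¬ form ≈ℍ (λ _ → 0#)
      character   : IsDirichletCharacter n ε
      diamond     : ∀ γ → γ ∈ Γ₀ n → form ∣[ k ] γ ≈ℍ (λ z → ε (M₂.d γ) * form z)
      hecke       : ∀ p → Prime p → ∃[ e ] IsHeckeEigenvalue k n p form e
      q-expansion : HasQExpansion form coeff
      coeff-0     : coeff 0 ≈ 0#
      coeff-1     : coeff 1 ≈ 1#

  data ℚ⟨_⟩ (a : ℕ → ℂ) : Pred ℂ 0ℓ where
    ≈-resp : ∀ {x y} → x ≈ y → ℚ⟨ a ⟩ x → ℚ⟨ a ⟩ y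
    gen    : ∀ m → ℚ⟨ a ⟩ (a m)
    one    : ℚ⟨ a ⟩ 1#
    add    : ∀ {x y} → ℚ⟨ a ⟩ x → ℚ⟨ a ⟩ y → ℚ⟨ a ⟩ (x + y)
    neg    : ∀ {x} → ℚ⟨ a ⟩ x → ℚ⟨ a ⟩ (- x)
    mul    : ∀ {x y} → ℚ⟨ a ⟩ x → ℚ⟨ a ⟩ y → ℚ⟨ a ⟩ (x * y)
    inv    : ∀ {x} → ℚ⟨ a ⟩ x → ℚ⟨ a ⟩ (x ⁻¹)

  ℚ̄ : Pred ℂ 0ℓ
  ℚ̄ x = ∃[ n ] Σ[ coeff ∈ (Fin n → ℤ) ] ∃[ j ] ¬ (coeff j ≡ + 0) ×
    eval (λ i → fromℤ (coeff i)) x ≈ 0#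

  ℤ̄ : Pred ℂ 0ℓ
  ℤ̄ x = ∃[ n ] Σ[ coeff ∈ (Fin n → ℤ) ] x ^ n + eval (λ i → fromℤ (coeff i)) x ≈ 0#

  K : ∀ {k n} → NormalizedEigenform k n → Pred ℂ 0ℓ
  K g = ℚ⟨ NormalizedEigenform.coeff g ⟩

  𝓞 : Pred ℂ 0ℓ → Pred ℂ 0ℓ
  𝓞 L = L ∩ ℤ̄

  -- Prime ideals 𝔭 of the subring A of ℂ with 𝔭 ∩ ℤ = pℤ.
  record IsPrimeOver (A : Pred ℂ 0ℓ) (p : ℕ) (𝔭 : Pred ℂ 0ℓ) : Set where
    field
      resp     : ∀ {x y} → x ≈ y → x ∈ 𝔭 → y ∈ 𝔭
      subset   : 𝔭 ⊆ A
      +-closed : ∀ {x y} → x ∈ 𝔭 → y ∈ 𝔭 → x + y ∈ 𝔭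
      absorb   : ∀ {x y} → x ∈ A → y ∈ 𝔭 → x * y ∈ 𝔭
      proper   : ¬ 1# ∈ 𝔭
      prime    : ∀ {x y} → x ∈ A → y ∈ A → x * y ∈ 𝔭 → x ∈ 𝔭 ⊎ y ∈ 𝔭
      over     : ∀ m → fromℤ m ∈ 𝔭 ⇔ (+ p) ∣ℤ m

  -- Representatives of the x mod nℓ with ε(x) x^e ≡ 1 mod 𝔭.
  CongruenceSubgroup : (ε : ℤ → ℂ) (𝔭 : Pred ℂ 0ℓ) (n ℓ : ℕ) (e : ℤ) → Pred ℕ 0ℓ
  CongruenceSubgroup ε 𝔭 n ℓ e x =
    0 ℕ.< x × x ℕ.< n ℕ.* ℓ × Coprime x (n ℕ.* ℓ) ×
    (∃[ y ] PowerMod ℓ (+ x) e y × (ε (+ x) * fromℤ y - 1#) ∈ 𝔭)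

  -- Gal(ℚ̄/ℚ). Only the values on ℚ̄ matter, see _≈ᴳ_ below.
  record Gal : Set where
    field
      fun        : ℂ → ℂ
      cong       : ∀ {x y} → x ≈ y → fun x ≈ fun y
      closed     : ∀ {x} → x ∈ ℚ̄ → fun x ∈ ℚ̄
      +-homo     : ∀ {x y} → x ∈ ℚ̄ → y ∈ ℚ̄ → fun (x + y) ≈ fun x + fun y
      *-homo     : ∀ {x y} → x ∈ ℚ̄ → y ∈ ℚ̄ → fun (x * y) ≈ fun x * fun y
      1-homo     : fun 1# ≈ 1#
      surjective : ∀ {y} → y ∈ ℚ̄ → ∃[ x ] x ∈ ℚ̄ × fun x ≈ y

  open Gal public using () renaming (fun to _⟨$⟩_)

  infix 4 _≈ᴳ_
  _≈ᴳ_ : Gal → Gal → Set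
  σ ≈ᴳ τ = ∀ x → x ∈ ℚ̄ → σ ⟨$⟩ x ≈ τ ⟨$⟩ x

  ≈-trans : ∀ {x y z : ℂ} → x ≈ y → y ≈ z → x ≈ z
  ≈-trans (p , q) (p′ , q′) = ℝ.trans p p′ , ℝ.trans q q′

  infixl 7 _∙_
  _∙_ : Gal → Gal → Gal
  σ ∙ τ = record
    { fun        = λ x → σ ⟨$⟩ (τ ⟨$⟩ x)
    ; cong       = λ p → σ.cong (τ.cong p)
    ; closed     = λ p → σ.closed (τ.closed p)
    ; +-homo     = λ p q → ≈-trans (σ.cong (τ.+-homo p q))
                                   (σ.+-homo (τ.closed p) (τ.closed q))
    ; *-homo     = λ p q → ≈-trans (σ.cong (τ.*-homo p q))
                                   (σ.*-homo (τ.closed p) (τ.closed q))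
    ; 1-homo     = ≈-trans (σ.cong τ.1-homo) σ.1-homo
    ; surjective = λ p → let y , q , σy≈z = σ.surjective p
                             x , r , τx≈y = τ.surjective q
                         in x , r , ≈-trans (σ.cong τx≈y) σy≈z
    }
    where module σ = Gal σ
          module τ = Gal τ

  Decomposition Inertia : Pred ℂ 0ℓ → Pred Gal 0ℓ
  Decomposition 𝔓 σ = ∀ x → x ∈ ℤ̄ → (σ ⟨$⟩ x) ∈ 𝔓 ⇔ x ∈ 𝔓
  Inertia 𝔓 σ = Decomposition 𝔓 σ × (∀ x → x ∈ ℤ̄ → (σ ⟨$⟩ x - x) ∈ 𝔓)

  Frobenius : ℕ → Pred ℂ 0ℓ → Pred Gal 0ℓ
  Frobenius p 𝔓 σ = Decomposition 𝔓 σ × (∀ x → x ∈ ℤ̄ → (σ ⟨$⟩ x - x ^ p) ∈ 𝔓)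

rawRing : HeytingField 0ℓ 0ℓ 0ℓ → RawRing 0ℓ 0ℓ
rawRing F = CommutativeRing.rawRing
  (HeytingCommutativeRing.commutativeRing (HeytingField.heytingCommutativeRing F))

record IsAlgebraicClosureOf𝔽 (ℓ : ℕ) (F : HeytingField 0ℓ 0ℓ 0ℓ) : Set where
  open HeytingField F using (Carrier; _≈_; _+_; 0#)
  open RingOperations (rawRing F)
  field
    characteristic : fromℕ ℓ ≈ 0#
    algebraic      : ∀ x → ∃[ n ] Σ[ coeff ∈ (Fin n → ℤ) ] ∃[ j ] ¬ (+ ℓ) ∣ℤ coeff j ×
                     eval (λ i → fromℤ (coeff i)) x ≈ 0#
    closed         : ∀ n (coeff : Fin (suc n) → Carrier) →
                     ∃[ x ] x ^ suc n + eval coeff x ≈ 0#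

module Representations (ℝ : RealField) (F : HeytingField 0ℓ 0ℓ 0ℓ) where
  open ModularForms ℝ
  private module F = HeytingField F
  open RingOperations (rawRing F) public
    using (det; _≈ₘ_; _*ₘ_; _*ₛ_; 1ₘ; charPoly)
  open RingOperations (rawRing F) using ()
    renaming (fromℕ to fromℕꟳ; _^_ to _^ꟳ_)

  record Representation : Set where
    field
      fun        : Gal → M₂ F.Carrier
      invertible : ∀ σ → det (fun σ) F.# F.0#
      cong       : ∀ {σ τ} → σ ≈ᴳ τ → fun σ ≈ₘ fun τ
      homo       : ∀ σ τ → fun (σ ∙ τ) ≈ₘ fun σ *ₘ fun τ
      -- for the Krull topology on Gal(ℚ̄/ℚ)
      continuous : ∀ σ → ∃[ xs ] All ℚ̄ xs ×
                   (∀ τ → All (λ x → τ ⟨$⟩ x ≈ σ ⟨$⟩ x) xs → fun τ ≈ₘ fun σ)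

  open Representation public using () renaming (fun to mapρ)

  F² : Set
  F² = F.Carrier × F.Carrier

  infix 4 _≈ᵥ_
  _≈ᵥ_ : F² → F² → Set
  (x , y) ≈ᵥ (x′ , y′) = (x F.≈ x′) × (y F.≈ y′)

  infixl 6 _+ᵥ_
  _+ᵥ_ : F² → F² → F²
  (x , y) +ᵥ (x′ , y′) = x F.+ x′ , y F.+ y′

  0ᵥ : F²
  0ᵥ = F.0# , F.0#

  act : M₂ F.Carrier → F² → F²
  act (mat a b c d) (x , y) = (a F.* x) F.+ (b F.* y) , (c F.* x) F.+ (d F.* y)

  record IsSubrepresentation (ρ : Representation) (W : Pred F² 0ℓ) : Set where
    field
      resp     : ∀ {v w} → v ≈ᵥ w → W v → W w
      0-closed : W 0ᵥ
      +-closed : ∀ {v w} → W v → W w → W (v +ᵥ w)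
      *-closed : ∀ t {x y} → W (x , y) → W (t F.* x , t F.* y)
      stable   : ∀ σ {v} → W v → W (act (mapρ ρ σ) v)

  Irreducible Semisimple : Representation → Set₁
  Irreducible ρ = ∀ W → IsSubrepresentation ρ W →
    (∀ v → W v → v ≈ᵥ 0ᵥ) ⊎ (∀ v → W v)
  Semisimple ρ = ∀ W → IsSubrepresentation ρ W →
    ∃[ W′ ] IsSubrepresentation ρ W′ ×
      (∀ v → W v → W′ v → v ≈ᵥ 0ᵥ) ×
      (∀ v → ∃[ w ] ∃[ w′ ] W w × W′ w′ × v ≈ᵥ w +ᵥ w′)

  infix 4 _≅_
  _≅_ : (ρ₁ ρ₂ : Gal → M₂ F.Carrier) → Set
  ρ₁ ≅ ρ₂ = ∃[ P ] det P F.# F.0# × (∀ σ → P *ₘ ρ₁ σ ≈ₘ ρ₂ σ *ₘ P)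

  infixl 7 _⊗_^_
  _⊗_^_ : (Gal → M₂ F.Carrier) → (Gal → F.Carrier) → ℕ → Gal → M₂ F.Carrier
  (ρ ⊗ χ ^ i) σ = (χ σ ^ꟳ i) *ₛ ρ σ

  IsCyclotomic : ℕ → (Gal → F.Carrier) → Set
  IsCyclotomic ℓ χ = ∀ σ → ∃[ m ] χ σ F.≈ fromℕꟳ m ×
    (∀ ζ → ζ ^ ℓ ≈ 1# → σ ⟨$⟩ ζ ≈ ζ ^ m)

  -- An embedding A/𝔭 ↪ F, as a map on A ⊆ ℂ with kernel 𝔭.
  record ResidueEmbedding (A 𝔭 : Pred ℂ 0ℓ) : Set where
    field
      fun    : ℂ → F.Carrier
      cong   : ∀ {x y} → x ∈ A → x ≈ y → fun x F.≈ fun y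
      +-homo : ∀ {x y} → x ∈ A → y ∈ A → fun (x + y) F.≈ fun x F.+ fun y
      *-homo : ∀ {x y} → x ∈ A → y ∈ A → fun (x * y) F.≈ fun x F.* fun y
      1-homo : fun 1# F.≈ F.1#
      kernel : ∀ {x} → x ∈ A → fun x F.≈ F.0# ⇔ x ∈ 𝔭

  -- ρ is ρ_{g,μ}, where μ ∣ ℓ is a prime of K_g with residue embedding ι.
  -- Frobenius is arithmetic; the values ε(p) belong to K_g. As F is infinite,
  -- comparing values at all t amounts to comparing polynomials.
  record IsAttached {k n : ℕ} (g : NormalizedEigenform k n) (ℓ : ℕ)
                    {μ : Pred ℂ 0ℓ} (ι : ResidueEmbedding (𝓞 (K g)) μ)
                    (ρ : Representation) : Set₁ where
    open NormalizedEigenform g using (coeff; ε)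
    open ResidueEmbedding ι using () renaming (fun to red)
    field
      semisimple : Semisimple ρ
      unramified : ∀ p → Prime p → ¬ p ∣ n ℕ.* ℓ → ∀ 𝔓 → IsPrimeOver ℤ̄ p 𝔓 →
                   ∀ σ → Inertia 𝔓 σ → mapρ ρ σ ≈ₘ 1ₘ
      charpoly   : ∀ p → Prime p → ¬ p ∣ n ℕ.* ℓ → ∀ 𝔓 → IsPrimeOver ℤ̄ p 𝔓 →
                   ∀ σ → Frobenius p 𝔓 σ → ∀ t →
                   charPoly (mapρ ρ σ) t F.≈
                     ((t F.* t) F.- (red (coeff p) F.* t))
                       F.+ red (ε (+ p) * fromℕ p ^ (k ∸ 1))

{-# OPTIONS --safe #-}

-- Since f ∣ γ = ε(d) f for γ ∈ Γ₀(N) with lower right entry d, and every unit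
-- modulo N is such an entry, f lies in S_k(Γ₀(N)) if and only if ε is trivial.
-- As ℓ − 1 divides e = k − 2 − 2i, Fermat's little theorem reduces the condition
-- defining H to ε(x) ≡ 1 mod 𝔩. By Euler's theorem ζ = ε(x) satisfies ζ^φ(N) = 1,
-- and if moreover ζ ≡ 1 mod 𝔩 but ζ ≠ 1, then 0 = 1 + ζ + … + ζ^(φ(N)−1) ≡ φ(N)
-- mod 𝔩, which ℓ ∤ φ(N) forbids. So H is everything exactly when ε is trivial on
-- the units modulo Nℓ, and these surject onto the units modulo N.
module Submission where

open import Defs hiding (rawRing)
open import Algebra.Apartness.Bundles using (HeytingField)
open import Algebra.Bundles using (CommutativeRing)
import Algebra.Properties.AbelianGroup as AbelianGroupProperties
import Algebra.Properties.CommutativeMonoid.Sum as SumProperties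
import Algebra.Properties.Ring as RingProperties
import Algebra.Properties.Semiring.Mult as MultProperties
import Algebra.Properties.Semiring.Mult.TCOptimised as MultProperties′
import Algebra.Solver.Ring
open import Algebra.Solver.Ring.AlmostCommutativeRing
  using (fromCommutativeRing; _-Raw-AlmostCommutative⟶_)
open import Data.Empty using (⊥-elim)
open import Data.Fin.Base using (Fin; zero; suc)
open import Data.Integer.Base as ℤ using (ℤ; +_; -[1+_])
import Data.Integer.Coprimality as ℤ
open import Data.Integer.DivMod using (_%ℕ_; _/ℕ_; n%ℕd<d; a≡a%ℕn+[a/ℕn]*n)
open import Data.Integer.Divisibility.Signed as ℤ∣ using () renaming (_∣_ to _∣ℤ_)
import Data.Integer.Properties as ℤ
open import Data.Integer.Tactic.RingSolver using (solve-∀)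
open import Data.List.Base using (List; []; _∷_; [_]; _++_; length; map; filter; applyUpTo)
open import Data.List.Membership.Propositional using () renaming (_∈_ to _∈ˡ_)
open import Data.List.Membership.Propositional.Properties
  using (∈-map⁺; ∈-map⁻; ∈-filter⁺; ∈-filter⁻; ∈-applyUpTo⁺; ∈-applyUpTo⁻)
open import Data.List.Membership.Propositional.Properties.WithK using (unique∧set⇒bag)
open import Data.List.Properties
  using (length-++; length-applyUpTo; applyUpTo-∷ʳ; filter-++; filter-all; filter-reject)
open import Data.List.Relation.Binary.BagAndSetEquality using (∼bag⇒↭)
open import Data.List.Relation.Binary.Permutation.Propositional using (_↭_)
open import Data.List.Relation.Unary.All as All using (All; []; _∷_)
import Data.List.Relation.Unary.All.Properties as All
open import Data.List.Relation.Unary.AllPairs using ([]; _∷_)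
open import Data.List.Relation.Unary.Any using (here; there)
open import Data.List.Relation.Unary.Unique.Propositional using (Unique)
import Data.List.Relation.Unary.Unique.Propositional.Properties as Unique
import Data.Maybe.Base as Maybe
open import Data.Nat.Base as ℕ using (ℕ; zero; suc; _∸_; s<s)
open import Data.Nat.Coprimality as Coprime using (Coprime; coprime?)
open import Data.Nat.Divisibility as ∣ using (_∣_; divides)
open import Data.Nat.GCD using (module Bézout)
open import Data.Nat.ListAction using (product)
open import Data.Nat.ListAction.Properties using (product-↭)
open import Data.Nat.Primality
  using (Prime; prime⇒nonZero; prime⇒nonTrivial; prime⇒irreducible)
import Data.Nat.Properties as ℕ
open import Data.Product.Base using (_×_; _,_; proj₁; proj₂; ∃-syntax; Σ-syntax)
open import Data.Sum.Base using (inj₁; inj₂)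
open import Function.Bundles using (_⇔_; mk⇔; Equivalence)
open import Level using (0ℓ)
open import Relation.Binary.Definitions using (Decidable; tri<; tri≈; tri>)
open import Relation.Binary.PropositionalEquality as ≡ using (_≡_)
open import Relation.Binary.Structures using (IsEquivalence; IsStrictTotalOrder)
open import Relation.Nullary.Decidable using (yes; no; dec⇒maybe; map′; _×-dec_)
open import Relation.Nullary.Negation using (¬_; contradiction)
open import Relation.Unary using (Pred; _∈_; _≐_)

-- Congruences and units modulo n

≡[mod]-refl : ∀ {n} x → x ≡ x [mod n ]
≡[mod]-refl {n} x = ≡.subst (+ n ∣ℤ_) (≡.sym (ℤ.+-inverseʳ x)) (ℤ∣.divides (+ 0) ≡.refl)

≡[mod]-sym : ∀ {n} x y → x ≡ y [mod n ] → y ≡ x [mod n ]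
≡[mod]-sym {n} x y p = ≡.subst (+ n ∣ℤ_) (lemma x y) (ℤ∣.∣m⇒∣-m p)
  where
  lemma : ∀ x y → ℤ.- (x ℤ.- y) ≡ y ℤ.- x
  lemma = solve-∀

≡[mod]-trans : ∀ {n} x y z → x ≡ y [mod n ] → y ≡ z [mod n ] → x ≡ z [mod n ]
≡[mod]-trans {n} x y z p q = ≡.subst (+ n ∣ℤ_) (lemma x y z) (ℤ∣.∣m∣n⇒∣m+n p q)
  where
  lemma : ∀ x y z → (x ℤ.- y) ℤ.+ (y ℤ.- z) ≡ x ℤ.- z
  lemma = solve-∀

*-cong-[mod] : ∀ {n} x y u v → x ≡ y [mod n ] → u ≡ v [mod n ] →
               x ℤ.* u ≡ y ℤ.* v [mod n ]
*-cong-[mod] {n} x y u v p q =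
  ≡.subst (+ n ∣ℤ_) (lemma x y u v) (ℤ∣.∣m∣n⇒∣m+n (ℤ∣.∣m⇒∣m*n u p) (ℤ∣.∣n⇒∣m*n y q))
  where
  lemma : ∀ x y u v → (x ℤ.- y) ℤ.* u ℤ.+ y ℤ.* (u ℤ.- v) ≡ x ℤ.* u ℤ.- y ℤ.* v
  lemma = solve-∀

^-≡1[mod] : ∀ {n} x m → x ≡ + 1 [mod n ] → x ℤ.^ m ≡ + 1 [mod n ]
^-≡1[mod] x zero    p = ≡[mod]-refl (+ 1)
^-≡1[mod] x (suc m) p = *-cong-[mod] x (+ 1) (x ℤ.^ m) (+ 1) p (^-≡1[mod] x m p)

≡[mod]-∣ : ∀ {m n} x y → m ∣ n → x ≡ y [mod n ] → x ≡ y [mod m ]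
≡[mod]-∣ x y m∣n = ℤ∣.∣-trans (ℤ∣.∣ᵤ⇒∣ m∣n)

*-cancelʳ-[mod] : ∀ {n} x y z → Coprime n ℤ.∣ z ∣ → x ℤ.* z ≡ y ℤ.* z [mod n ] →
                  x ≡ y [mod n ]
*-cancelʳ-[mod] {n} x y z n⊥z p =
  ℤ∣.∣ᵤ⇒∣ (ℤ.coprime-divisor (+ n) z (x ℤ.- y) n⊥z
    (ℤ∣.∣⇒∣ᵤ (≡.subst (+ n ∣ℤ_) (lemma x y z) p)))
  where
  lemma : ∀ x y z → x ℤ.* z ℤ.- y ℤ.* z ≡ z ℤ.* (x ℤ.- y)
  lemma = solve-∀

coprime-≡[mod] : ∀ {n} x y → x ≡ y [mod n ] → Coprime ℤ.∣ x ∣ n → Coprime ℤ.∣ y ∣ n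
coprime-≡[mod] {n} x y p x⊥n {d} (d∣y , d∣n) = x⊥n (ℤ∣.∣⇒∣ᵤ {+ d} {x} d∣x , d∣n)
  where
  lemma : ∀ x y → (x ℤ.- y) ℤ.+ y ≡ x
  lemma = solve-∀
  d∣x : + d ∣ℤ x
  d∣x = ≡.subst (+ d ∣ℤ_) (lemma x y)
    (ℤ∣.∣m∣n⇒∣m+n (ℤ∣.∣-trans (ℤ∣.∣ᵤ⇒∣ d∣n) p) (ℤ∣.∣ᵤ⇒∣ {+ d} {y} d∣y))

-- A common divisor d of ab and n is prime to a because d divides n, so d divides b.
coprime-*ˡ : ∀ {a b n} → Coprime a n → Coprime b n → Coprime (a ℕ.* b) n
coprime-*ˡ a⊥n b⊥n (d∣ab , d∣n) = b⊥n
  ( Coprime.coprime-divisor (λ (e∣d , e∣a) → a⊥n (e∣a , ∣.∣-trans e∣d d∣n)) d∣ab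
  , d∣n)

coprime-∣ʳ : ∀ {a m n} → m ∣ n → Coprime a n → Coprime a m
coprime-∣ʳ m∣n a⊥n (d∣a , d∣m) = a⊥n (d∣a , ∣.∣-trans d∣m m∣n)

prime∤⇒coprime : ∀ {p n} → Prime p → ¬ p ∣ n → Coprime n p
prime∤⇒coprime pr p∤n (d∣n , d∣p) with prime⇒irreducible pr d∣p
... | inj₁ d≡1  = d≡1
... | inj₂ ≡.refl = contradiction d∣n p∤n

-- One of the residues x and x + N is a unit modulo N p.
lift-coprime : ∀ {N p} → Prime p → Coprime N p → ∀ x → Coprime x N →
               ∃[ y ] Coprime y (N ℕ.* p) × + y ≡ + x [mod N ]
lift-coprime {N} {p} pr N⊥p x x⊥N with p ∣.∣? x
... | no p∤x = x
  , Coprime.sym (coprime-*ˡ (Coprime.sym x⊥N) (Coprime.sym (prime∤⇒coprime pr p∤x)))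
  , ≡[mod]-refl (+ x)
... | yes p∣x = N ℕ.+ x
  , Coprime.sym (coprime-*ˡ (Coprime.sym (Coprime.coprime-+ x⊥N))
      (Coprime.sym (prime∤⇒coprime pr p∤N+x)))
  , ≡.subst (+ N ∣ℤ_) (≡.sym (lemma (+ N) (+ x))) ℤ∣.∣-refl
  where
  lemma : ∀ n x → (n ℤ.+ x) ℤ.- x ≡ n
  lemma = solve-∀
  p∤N+x : ¬ p ∣ N ℕ.+ x
  p∤N+x p∣N+x = ℕ.nonTrivial⇒≢1 {{prime⇒nonTrivial pr}}
    (N⊥p (∣.∣m+n∣m⇒∣n (≡.subst (p ∣_) (ℕ.+-comm N x) p∣N+x) p∣x , ∣.∣-refl))

module _ {n} .{{_ : ℕ.NonZero n}} where

  %ℕ-≡[mod] : ∀ z → + (z %ℕ n) ≡ z [mod n ]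
  %ℕ-≡[mod] z = ≡[mod]-sym z (+ (z %ℕ n))
    (ℤ∣.divides (z /ℕ n) (≡.trans (≡.cong (ℤ._- + (z %ℕ n)) (a≡a%ℕn+[a/ℕn]*n z n))
      (lemma (+ (z %ℕ n)) ((z /ℕ n) ℤ.* + n))))
    where
    lemma : ∀ r q → (r ℤ.+ q) ℤ.- r ≡ q
    lemma = solve-∀

  -- The distance between a and b is at most max(a, b) < n, and a multiple of n that small is 0.
  residue-unique : ∀ {a b} → a ℕ.< n → b ℕ.< n → + a ≡ + b [mod n ] → a ≡ b
  residue-unique {a} {b} a<n b<n p with ℤ.∣ a ℤ.⊖ b ∣ in eq
  ... | zero  = ℤ.+-injective (ℤ.i-j≡0⇒i≡j (+ a) (+ b)
                  (≡.trans (ℤ.m-n≡m⊖n a b) (ℤ.∣i∣≡0⇒i≡0 eq)))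
  ... | suc d = contradiction
    (≡.subst (ℕ._< n) eq (ℕ.≤-<-trans (ℤ.∣m⊝n∣≤m⊔n a b) (ℕ.⊔-lub a<n b<n)))
    (ℕ.≤⇒≯ (∣.∣⇒≤ (≡.subst (n ∣_) (≡.trans (≡.cong ℤ.∣_∣ (ℤ.m-n≡m⊖n a b)) eq) (ℤ∣.∣⇒∣ᵤ p))))

-- This form of the identity serves twice: modulo n it makes a an inverse of x, and its left side is
-- the determinant of (a b; n x), as used in `Γ₀-element`.
bézout : ∀ {x n} → Coprime x n → ∃[ a ] ∃[ b ] a ℤ.* + x ℤ.- b ℤ.* + n ≡ + 1
bézout {x} {n} x⊥n with Coprime.coprime-Bézout x⊥n
... | Bézout.+- u v eq = + u , + v , (begin
  + u ℤ.* + x ℤ.- + v ℤ.* + n         ≡⟨ ≡.cong₂ ℤ._-_ (ℤ.pos-* u x) (ℤ.pos-* v n) ⟨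
  + (u ℕ.* x) ℤ.- + (v ℕ.* n)         ≡⟨ ≡.cong (λ t → + t ℤ.- + (v ℕ.* n)) eq ⟨
  (+ 1 ℤ.+ + (v ℕ.* n)) ℤ.- + (v ℕ.* n) ≡⟨ lemma (+ (v ℕ.* n)) ⟩
  + 1 ∎)
  where
  open ≡.≡-Reasoning
  lemma : ∀ t → (+ 1 ℤ.+ t) ℤ.- t ≡ + 1
  lemma = solve-∀
-- Here the identity over ℕ reads 1 + u x = v n, so both coefficients change sign.
... | Bézout.-+ u v eq = ℤ.- + u , ℤ.- + v , (begin
  (ℤ.- + u) ℤ.* + x ℤ.- (ℤ.- + v) ℤ.* + n ≡⟨ lemma (+ u) (+ x) (+ v) (+ n) ⟩
  + v ℤ.* + n ℤ.- + u ℤ.* + x           ≡⟨ ≡.cong₂ ℤ._-_ (ℤ.pos-* v n) (ℤ.pos-* u x) ⟨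
  + (v ℕ.* n) ℤ.- + (u ℕ.* x)           ≡⟨ ≡.cong (λ t → + t ℤ.- + (u ℕ.* x)) eq ⟨
  (+ 1 ℤ.+ + (u ℕ.* x)) ℤ.- + (u ℕ.* x) ≡⟨ lemma′ (+ (u ℕ.* x)) ⟩
  + 1 ∎)
  where
  open ≡.≡-Reasoning
  lemma : ∀ u x v n → (ℤ.- u) ℤ.* x ℤ.- (ℤ.- v) ℤ.* n ≡ v ℤ.* n ℤ.- u ℤ.* x
  lemma = solve-∀
  lemma′ : ∀ t → (+ 1 ℤ.+ t) ℤ.- t ≡ + 1
  lemma′ = solve-∀

-- Permutations of lists and Euler's theorem

module _ {A : Set} where

  -- Injectivity is asked on members of `xs` only: multiplying by a unit and reducing modulo n is
  -- injective on reduced residues, not on all of ℕ.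
  unique-map : ∀ {B : Set} {f : A → B} xs →
               (∀ {x y} → x ∈ˡ xs → y ∈ˡ xs → f x ≡ f y → x ≡ y) →
               Unique xs → Unique (map f xs)
  unique-map []       inj []           = []
  unique-map (x ∷ xs) inj (x≢ ∷ uniq) =
    All.map⁺ (All.tabulate λ y∈xs fx≡fy →
      All.lookup x≢ y∈xs (inj (here ≡.refl) (there y∈xs) fx≡fy))
    ∷ unique-map xs (λ p q → inj (there p) (there q)) uniq

  -- The inverse `g` shows that `map f xs` is free of repetitions and has the same members as `xs`;
  -- two such lists are equal as bags, hence up to order.
  map-↭ : ∀ {xs : List A} {f g : A → A} → Unique xs →
          (∀ {x} → x ∈ˡ xs → f x ∈ˡ xs × g (f x) ≡ x) →
          (∀ {x} → x ∈ˡ xs → g x ∈ˡ xs × f (g x) ≡ x) →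
          map f xs ↭ xs
  map-↭ {xs} {f} {g} uniq gf fg = ∼bag⇒↭ (unique∧set⇒bag
    (unique-map xs (λ p q eq → ≡.trans (≡.sym (proj₂ (gf p))) (≡.trans (≡.cong g eq) (proj₂ (gf q)))) uniq)
    uniq
    (mk⇔ (λ p → let x , x∈xs , eq = ∈-map⁻ f p in ≡.subst (_∈ˡ xs) (≡.sym eq) (proj₁ (gf x∈xs)))
         (λ p → ≡.subst (_∈ˡ map f xs) (proj₂ (fg p)) (∈-map⁺ f (proj₁ (fg p))))))

-- The list counted by the totient: `φ n` unfolds to `length (units n)`, which is how the exponent
-- in Euler's theorem arises.
units : ℕ → List ℕ
units n = filter (λ x → coprime? x n) (applyUpTo suc n)

units-coprime : ∀ n → All (λ x → Coprime x n) (units n)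
units-coprime n = All.all-filter (λ x → coprime? x n) (applyUpTo suc n)

product-coprime : ∀ {n xs} → All (λ x → Coprime x n) xs → Coprime (product xs) n
product-coprime []         = Coprime.1-coprimeTo _
product-coprime (x⊥ ∷ xs⊥) = coprime-*ˡ x⊥ (product-coprime xs⊥)

-- Every factor contributes one x, so the exponent is the length of the list, which is φ(n) when
-- `as` is `units n`.
product-map-[mod] : ∀ {n} (f : ℕ → ℕ) x → (∀ a → + f a ≡ x ℤ.* + a [mod n ]) → ∀ as →
                    + product (map f as) ≡ x ℤ.^ length as ℤ.* + product as [mod n ]
product-map-[mod] f x f≡ []       = ≡[mod]-refl (+ 1)
product-map-[mod] {n} f x f≡ (a ∷ as) =
  ≡.subst (_≡ x ℤ.^ length (a ∷ as) ℤ.* + product (a ∷ as) [mod n ])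
    (≡.sym (ℤ.pos-* (f a) (product (map f as))))
    (≡.subst (+ f a ℤ.* + product (map f as) ≡_[mod n ])
      (≡.trans (lemma x (+ a) (x ℤ.^ length as) (+ product as))
             (≡.cong (x ℤ.^ length (a ∷ as) ℤ.*_) (≡.sym (ℤ.pos-* a (product as)))))
      (*-cong-[mod] (+ f a) (x ℤ.* + a) (+ product (map f as)) _
        (f≡ a) (product-map-[mod] f x f≡ as)))
  where
  lemma : ∀ x a y p → (x ℤ.* a) ℤ.* (y ℤ.* p) ≡ (x ℤ.* y) ℤ.* (a ℤ.* p)
  lemma = solve-∀

module _ {n} .{{_ : ℕ.NonTrivial n}} where
  private instance
    n≢0 : ℕ.NonZero n
    n≢0 = ℕ.nonTrivial⇒nonZero n

  ∈-units⁺ : ∀ {a} → a ℕ.< n → Coprime a n → a ∈ˡ units n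
  ∈-units⁺ {zero}  _   a⊥n = ⊥-elim (Coprime.¬0-coprimeTo-2+ a⊥n)
  ∈-units⁺ {suc a} a<n a⊥n =
    ∈-filter⁺ (λ x → coprime? x n) (∈-applyUpTo⁺ suc (ℕ.<-trans (ℕ.n<1+n a) a<n)) a⊥n

  ∈-units⁻ : ∀ {a} → a ∈ˡ units n → a ℕ.< n × Coprime a n
  ∈-units⁻ a∈ with ∈-filter⁻ (λ x → coprime? x n) {xs = applyUpTo suc n} a∈
  ... | a∈′ , a⊥n with ∈-applyUpTo⁻ suc {n = n} a∈′
  -- `applyUpTo suc n` ends at n itself, which for n > 1 is not prime to n.
  ...   | i , i<n , ≡.refl = ℕ.≤∧≢⇒< i<n
            (λ { ≡.refl → ℕ.nonTrivial⇒≢1 {n} (a⊥n (∣.∣-refl , ∣.∣-refl)) }) , a⊥n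

  units-unique : Unique (units n)
  units-unique = Unique.filter⁺ (λ x → coprime? x n)
    (Unique.applyUpTo⁺₁ suc n (λ i<j _ eq → ℕ.<⇒≢ i<j (ℕ.suc-injective eq)))

  -- The multiplier is an integer because the inverse supplied by `bézout` may be negative.
  scale : ℤ → ℕ → ℕ
  scale x a = (x ℤ.* + a) %ℕ n

  scale-∈ : ∀ x → Coprime ℤ.∣ x ∣ n → ∀ {a} → a ∈ˡ units n → scale x a ∈ˡ units n
  scale-∈ x x⊥n {a} a∈ = ∈-units⁺ (n%ℕd<d (x ℤ.* + a) n)
    (coprime-≡[mod] (x ℤ.* + a) (+ scale x a)
      (≡[mod]-sym (+ scale x a) (x ℤ.* + a) (%ℕ-≡[mod] (x ℤ.* + a)))
      (≡.subst (λ t → Coprime t n) (≡.sym (ℤ.abs-* x (+ a)))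
        (coprime-*ˡ x⊥n (proj₂ (∈-units⁻ a∈)))))

  scale-inverse : ∀ x y → y ℤ.* x ≡ + 1 [mod n ] → ∀ {a} → a ∈ˡ units n →
                  scale y (scale x a) ≡ a
  scale-inverse x y yx≡1 {a} a∈ = residue-unique
    (n%ℕd<d (y ℤ.* + scale x a) n) (proj₁ (∈-units⁻ a∈))
    (≡[mod]-trans (+ scale y (scale x a)) (y ℤ.* + scale x a) (+ a) (%ℕ-≡[mod] (y ℤ.* + scale x a))
    (≡[mod]-trans (y ℤ.* + scale x a) (y ℤ.* (x ℤ.* + a)) (+ a)
      (*-cong-[mod] y y (+ scale x a) (x ℤ.* + a) (≡[mod]-refl y) (%ℕ-≡[mod] (x ℤ.* + a)))
    (≡.subst (_≡ + a [mod n ]) (ℤ.*-assoc y x (+ a))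
      (≡.subst ((y ℤ.* x) ℤ.* + a ≡_[mod n ]) (ℤ.*-identityˡ (+ a))
        (*-cong-[mod] (y ℤ.* x) (+ 1) (+ a) (+ a) yx≡1 (≡[mod]-refl (+ a)))))))

  -- Multiplication by x permutes the units modulo n.
  euler-nonTrivial : ∀ x → Coprime x n → (+ x) ℤ.^ φ n ≡ + 1 [mod n ]
  euler-nonTrivial x x⊥n with bézout x⊥n
  -- With P the product of the units, the permutation gives x^φ(n) P ≡ P, and P, being prime to n,
  -- cancels.
  ... | y , b , yx-bn≡1 = *-cancelʳ-[mod] ((+ x) ℤ.^ φ n) (+ 1) (+ product (units n))
    (Coprime.sym (product-coprime (units-coprime n)))
    (≡[mod]-sym (+ 1 ℤ.* + product (units n)) ((+ x) ℤ.^ φ n ℤ.* + product (units n))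
    (≡.subst (_≡ (+ x) ℤ.^ φ n ℤ.* + product (units n) [mod n ])
      (≡.trans (≡.cong +_ (product-↭ permutation)) (≡.sym (ℤ.*-identityˡ (+ product (units n)))))
      (product-map-[mod] (scale (+ x)) (+ x) (λ a → %ℕ-≡[mod] (+ x ℤ.* + a)) (units n))))
    where
    lemma : ∀ s t → s ℤ.- (s ℤ.- t) ≡ t
    lemma = solve-∀
    yx≡1 : y ℤ.* + x ≡ + 1 [mod n ]
    yx≡1 = ℤ∣.divides b (≡.trans (≡.cong (λ t → y ℤ.* + x ℤ.- t) (≡.sym yx-bn≡1)) (lemma (y ℤ.* + x) (b ℤ.* + n)))
    xy≡1 : + x ℤ.* y ≡ + 1 [mod n ]
    xy≡1 = ≡.subst (_≡ + 1 [mod n ]) (ℤ.*-comm y (+ x)) yx≡1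
    y⊥n : Coprime ℤ.∣ y ∣ n
    y⊥n {d} (d∣y , d∣n) = ∣.∣1⇒≡1 (ℤ∣.∣⇒∣ᵤ {+ d} {+ 1} (≡.subst (+ d ∣ℤ_) yx-bn≡1
      (ℤ∣.∣m∣n⇒∣m-n (ℤ∣.∣m⇒∣m*n (+ x) (ℤ∣.∣ᵤ⇒∣ {+ d} {y} d∣y))
                    (ℤ∣.∣n⇒∣m*n b (ℤ∣.∣ᵤ⇒∣ {+ d} {+ n} d∣n)))))
    permutation : map (scale (+ x)) (units n) ↭ units n
    permutation = map-↭ {g = scale y} units-unique
      (λ a∈ → scale-∈ (+ x) x⊥n a∈ , scale-inverse (+ x) y yx≡1 a∈)
      (λ a∈ → scale-∈ y y⊥n a∈ , scale-inverse y (+ x) xy≡1 a∈)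

euler : ∀ n .{{_ : ℕ.NonZero n}} x → Coprime x n → (+ x) ℤ.^ φ n ≡ + 1 [mod n ]
-- Modulo 1 all integers are congruent. The permutation argument does not cover this case: `units 1`
-- is `[ 1 ]`, and 1 is not a residue below 1.
euler 1               x _ = ℤ∣.∣ᵤ⇒∣ (∣.1∣ _)
euler n@(suc (suc _)) x   = euler-nonTrivial x

-- Of the numbers 1, ..., p only the last is not prime to p.
φ-prime : ∀ {p} → Prime p → φ p ≡ p ∸ 1
φ-prime {suc m} pr = begin
  length (filter P? (applyUpTo suc (suc m)))
    ≡⟨ ≡.cong (λ xs → length (filter P? xs)) (applyUpTo-∷ʳ suc m) ⟨
  length (filter P? (applyUpTo suc m ++ [ suc m ]))
    ≡⟨ ≡.cong length (filter-++ P? (applyUpTo suc m) [ suc m ]) ⟩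
  length (filter P? (applyUpTo suc m) ++ filter P? [ suc m ])
    ≡⟨ length-++ (filter P? (applyUpTo suc m)) ⟩
  length (filter P? (applyUpTo suc m)) ℕ.+ length (filter P? [ suc m ])
    ≡⟨ ≡.cong₂ (λ xs ys → length xs ℕ.+ length ys)
         (filter-all P? (All.applyUpTo⁺₁ suc m λ i<m →
           Coprime.sym (Coprime.prime⇒coprime pr (s<s i<m))))
         (filter-reject P? {suc m} {[]} λ c →
           ℕ.nonTrivial⇒≢1 {{prime⇒nonTrivial pr}} (c (∣.∣-refl , ∣.∣-refl))) ⟩
  length (applyUpTo suc m) ℕ.+ 0
    ≡⟨ ℕ.+-identityʳ _ ⟩
  length (applyUpTo suc m)
    ≡⟨ length-applyUpTo suc m ⟩
  m ∎
  where
  open ≡.≡-Reasoning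
  P? = λ x → coprime? x (suc m)

-- Fermat's little theorem and powers with integer exponents

module _ {p} (pr : Prime p) {x} (x⊥p : Coprime x p) where

  fermat-∣ : ∀ {m} → (p ∸ 1) ∣ m → (+ x) ℤ.^ m ≡ + 1 [mod p ]
  fermat-∣ (divides q ≡.refl) =
    ≡.subst (_≡ + 1 [mod p ])
      (≡.trans (ℤ.^-*-assoc (+ x) (p ∸ 1) q) (≡.cong ((+ x) ℤ.^_) (ℕ.*-comm (p ∸ 1) q)))
      (^-≡1[mod] ((+ x) ℤ.^ (p ∸ 1)) q
        (≡.subst (λ t → (+ x) ℤ.^ t ≡ + 1 [mod p ]) (φ-prime pr)
          (euler p {{prime⇒nonZero pr}} x x⊥p)))

  -- Divisibility by p - 1 passes to the absolute value of e, so Fermat applies for either sign. For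
  -- negative e, y is known only through x^|e| y ≡ 1, and x^|e| ≡ 1 turns this into y ≡ 1.
  PowerMod⁻ : ∀ e {y} → + (p ∸ 1) ∣ℤ e → PowerMod p (+ x) e y → y ≡ + 1 [mod p ]
  PowerMod⁻ (+ m)    {y} p-1∣e y≡ =
    ≡[mod]-trans y ((+ x) ℤ.^ m) (+ 1) y≡ (fermat-∣ (ℤ∣.∣⇒∣ᵤ p-1∣e))
  PowerMod⁻ -[1+ m ] {y} p-1∣e xy≡1 =
    ≡[mod]-trans y ((+ x) ℤ.^ suc m ℤ.* y) (+ 1)
      (≡[mod]-sym ((+ x) ℤ.^ suc m ℤ.* y) y
        (≡.subst ((+ x) ℤ.^ suc m ℤ.* y ≡_[mod p ]) (ℤ.*-identityˡ y)
          (*-cong-[mod] ((+ x) ℤ.^ suc m) (+ 1) y y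
            (fermat-∣ (ℤ∣.∣⇒∣ᵤ p-1∣e)) (≡[mod]-refl y))))
      xy≡1

  PowerMod-1 : ∀ e → + (p ∸ 1) ∣ℤ e → PowerMod p (+ x) e (+ 1)
  PowerMod-1 (+ m)    p-1∣e = ≡[mod]-sym ((+ x) ℤ.^ m) (+ 1) (fermat-∣ (ℤ∣.∣⇒∣ᵤ p-1∣e))
  PowerMod-1 -[1+ m ] p-1∣e =
    ≡.subst (_≡ + 1 [mod p ]) (≡.sym (ℤ.*-identityʳ ((+ x) ℤ.^ suc m)))
      (fermat-∣ (ℤ∣.∣⇒∣ᵤ p-1∣e))

-- Bézout completes the bottom row (n, x) to a matrix of determinant 1. These matrices test both
-- invariance of the form and the inclusion of Γ₀ in Γ_H.
Γ₀-element : ∀ {x n} → Coprime x n → ∃[ γ ] Γ₀ n γ × M₂.d γ ≡ + x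
Γ₀-element {x} {n} x⊥n = let a , b , ax-bn≡1 = bézout x⊥n in
  mat a b (+ n) (+ x) ,
  (ax-bn≡1 , ≡.subst (+ n ∣ℤ_) (≡.sym (ℤ.+-identityʳ (+ n))) ℤ∣.∣-refl , x , x⊥n , ≡[mod]-refl (+ x)) ,
  ≡.refl

-- Integer constants in rings, and the field of complex numbers

module IntegerCoefficients (R : CommutativeRing 0ℓ 0ℓ) where
  open CommutativeRing R
  open RingOperations rawRing public using (fromℤ)
  open AbelianGroupProperties +-abelianGroup public using (⁻¹-∙-comm; ⁻¹-involutive; ε⁻¹≈ε; x∙y⁻¹≈ε⇒x≈y)
  open RingProperties ring public using (-‿distribˡ-*)
  open MultProperties semiring using (×-homo-+) renaming (_×_ to _·_)
  open MultProperties′ semiring using (×ᵤ≈×) renaming (_×_ to _·′_)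
  open import Relation.Binary.Reasoning.Setoid setoid

  -- Sums of integers of opposite sign compute to `⊖`. In the induction, inserting 1 - 1 raises both
  -- terms together.
  fromℤ-⊖ : ∀ m n → fromℤ (m ℤ.⊖ n) ≈ m · 1# - n · 1#
  fromℤ-⊖ m       zero    = sym (trans (+-congˡ ε⁻¹≈ε) (+-identityʳ _))
  fromℤ-⊖ zero    (suc n) = sym (+-identityˡ _)
  fromℤ-⊖ (suc m) (suc n) = begin
    fromℤ (suc m ℤ.⊖ suc n)                  ≡⟨ ≡.cong fromℤ (ℤ.[1+m]⊖[1+n]≡m⊖n m n) ⟩
    fromℤ (m ℤ.⊖ n)                          ≈⟨ fromℤ-⊖ m n ⟩
    m · 1# - n · 1#                          ≈⟨ +-congʳ (+-identityʳ _) ⟨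
    (m · 1# + 0#) - n · 1#                   ≈⟨ +-congʳ (+-congˡ (-‿inverseʳ 1#)) ⟨
    (m · 1# + (1# - 1#)) - n · 1#            ≈⟨ +-congʳ (+-assoc _ _ _) ⟨
    ((m · 1# + 1#) - 1#) - n · 1#            ≈⟨ +-assoc _ _ _ ⟩
    (m · 1# + 1#) + (- 1# + - (n · 1#))      ≈⟨ +-cong (+-comm _ _) (⁻¹-∙-comm _ _) ⟩
    (1# + m · 1#) - (1# + n · 1#)            ∎

  fromℤ-+ : ∀ i j → fromℤ (i ℤ.+ j) ≈ fromℤ i + fromℤ j
  fromℤ-+ (+ m)    (+ n)    = ×-homo-+ 1# m n
  fromℤ-+ (+ m)    -[1+ n ] = fromℤ-⊖ m (suc n)
  fromℤ-+ -[1+ m ] (+ n)    = trans (fromℤ-⊖ n (suc m)) (+-comm _ _)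
  fromℤ-+ -[1+ m ] -[1+ n ] = begin
    - (suc (suc (m ℕ.+ n)) · 1#)       ≡⟨ ≡.cong (λ t → - (suc t · 1#)) (ℕ.+-suc m n) ⟨
    - ((suc m ℕ.+ suc n) · 1#)         ≈⟨ -‿cong (×-homo-+ 1# (suc m) (suc n)) ⟩
    - (suc m · 1# + suc n · 1#)        ≈⟨ ⁻¹-∙-comm _ _ ⟨
    - (suc m · 1#) + - (suc n · 1#)    ∎

  fromℤ-neg : ∀ i → fromℤ (ℤ.- i) ≈ - fromℤ i
  fromℤ-neg (+ zero)  = sym ε⁻¹≈ε
  fromℤ-neg (+ suc n) = refl
  fromℤ-neg -[1+ n ]  = sym (⁻¹-involutive _)

  fromℤ-1 : fromℤ (+ 1) ≈ 1#
  fromℤ-1 = +-identityʳ 1#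

  fromℤ-pos-* : ∀ m j → fromℤ (+ m ℤ.* j) ≈ fromℤ (+ m) * fromℤ j
  fromℤ-pos-* zero    j = sym (zeroˡ _)
  fromℤ-pos-* (suc m) j = begin
    fromℤ (+ suc m ℤ.* j)               ≡⟨ ≡.cong fromℤ (ℤ.suc-* (+ m) j) ⟩
    fromℤ (j ℤ.+ + m ℤ.* j)             ≈⟨ fromℤ-+ j (+ m ℤ.* j) ⟩
    fromℤ j + fromℤ (+ m ℤ.* j)         ≈⟨ +-cong (sym (*-identityˡ _)) (fromℤ-pos-* m j) ⟩
    1# * fromℤ j + m · 1# * fromℤ j     ≈⟨ distribʳ _ _ _ ⟨
    (1# + m · 1#) * fromℤ j             ∎

  fromℤ-* : ∀ i j → fromℤ (i ℤ.* j) ≈ fromℤ i * fromℤ j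
  fromℤ-* (+ m)    j = fromℤ-pos-* m j
  fromℤ-* -[1+ m ] j = begin
    fromℤ (ℤ.- + suc m ℤ.* j)      ≡⟨ ≡.cong fromℤ (ℤ.neg-distribˡ-* (+ suc m) j) ⟨
    fromℤ (ℤ.- (+ suc m ℤ.* j))    ≈⟨ fromℤ-neg (+ suc m ℤ.* j) ⟩
    - fromℤ (+ suc m ℤ.* j)        ≈⟨ -‿cong (fromℤ-pos-* (suc m) j) ⟩
    - (suc m · 1# * fromℤ j)       ≈⟨ -‿distribˡ-* _ _ ⟩
    - (suc m · 1#) * fromℤ j       ∎

  -- Unlike fromℤ, this sends 1 to 1# on the nose, so that solver constants
  -- match the constants 0#, 1# of the ring.
  ⟦_⟧ᶜ : ℤ → Carrier
  ⟦ + n ⟧ᶜ      = n ·′ 1#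
  ⟦ -[1+ n ] ⟧ᶜ = - (suc n ·′ 1#)

  fromℤ≈⟦⟧ᶜ : ∀ i → fromℤ i ≈ ⟦ i ⟧ᶜ
  fromℤ≈⟦⟧ᶜ (+ n)    = ×ᵤ≈× n 1#
  fromℤ≈⟦⟧ᶜ -[1+ n ] = -‿cong (×ᵤ≈× (suc n) 1#)

  coefficientMorphism : ℤ.+-*-rawRing -Raw-AlmostCommutative⟶ fromCommutativeRing R
  coefficientMorphism = record
    { ⟦_⟧    = ⟦_⟧ᶜ
    ; +-homo = λ i j → via (i ℤ.+ j) (fromℤ-+ i j) (+-cong (fromℤ≈⟦⟧ᶜ i) (fromℤ≈⟦⟧ᶜ j))
    ; *-homo = λ i j → via (i ℤ.* j) (fromℤ-* i j) (*-cong (fromℤ≈⟦⟧ᶜ i) (fromℤ≈⟦⟧ᶜ j))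
    ; -‿homo = λ i → via (ℤ.- i) (fromℤ-neg i) (-‿cong (fromℤ≈⟦⟧ᶜ i))
    ; 0-homo = refl
    ; 1-homo = refl
    }
    where
    via : ∀ i {x y} → fromℤ i ≈ x → x ≈ y → ⟦ i ⟧ᶜ ≈ y
    via i p q = trans (sym (fromℤ≈⟦⟧ᶜ i)) (trans p q)

  -- Coefficients are integers, so their equality is decided in ℤ and the solver can cancel terms
  -- over any commutative ring.
  module RingSolver = Algebra.Solver.Ring ℤ.+-*-rawRing (fromCommutativeRing R)
    coefficientMorphism
    (λ i j → Maybe.map (λ i≡j → reflexive (≡.cong ⟦_⟧ᶜ i≡j)) (dec⇒maybe (i ℤ.≟ j)))

-- Inverses and squares in the ordered field ℝ

module RealProperties (ℝ : RealField) where
  open RealField ℝ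
  open IsStrictTotalOrder isStrictTotalOrder public
    using (_≟_; <-resp-≈; irrefl) renaming (trans to <-trans)

  commutativeRing : CommutativeRing 0ℓ 0ℓ
  commutativeRing = record { isCommutativeRing = isCommutativeRing }

  open IntegerCoefficients commutativeRing public
  open RingSolver using (solve; _:=_; _:+_; _:*_; _:-_; :-_; con)

  <-respʳ : ∀ {x y z} → y ≈ z → x < y → x < z
  <-respʳ = proj₁ <-resp-≈

  <-respˡ : ∀ {x y z} → y ≈ z → y < x → z < x
  <-respˡ = proj₂ <-resp-≈

  *-inverseʳ : ∀ {x} → 0# < x → x * x ⁻¹ ≈ 1#
  *-inverseʳ {x} 0<x with compare x 0#
  ... | tri< _ _ x≯0 = ⊥-elim (x≯0 0<x)
  ... | tri≈ _ _ x≯0 = ⊥-elim (x≯0 0<x)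
  -- The apartness of 0 and x inverts the difference 0 - x, which is why `_⁻¹` carries a minus sign
  -- in this case.
  ... | tri> _ _ 0<x′ = let y , _ , [0-x]y≈1 = #⇒invertible (<⇒# 0<x′) in
    trans (solve 2 (λ x y → x :* (:- y) := (con (+ 0) :- x) :* y) refl x y) [0-x]y≈1

  +-pos : ∀ {x y} → 0# < x → ¬ (y < 0#) → 0# < x + y
  +-pos {x} {y} 0<x y≮0 with compare 0# y
  ... | tri> _ _ y<0 = ⊥-elim (y≮0 y<0)
  ... | tri≈ _ 0≈y _ = <-respʳ (trans (sym (+-identityʳ x)) (+-congˡ 0≈y)) 0<x
  ... | tri< 0<y _ _ = <-trans 0<y (<-respˡ (+-identityˡ y) (+-monoˡ-< y 0<x))

  square-pos : ∀ {x} → ¬ x ≈ 0# → 0# < x * x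
  square-pos {x} x≉0 with compare x 0#
  ... | tri≈ _ x≈0 _ = ⊥-elim (x≉0 x≈0)
  ... | tri> _ _ 0<x = *-pos 0<x 0<x
  ... | tri< x<0 _ _ = <-respʳ (solve 1 (λ x → (:- x) :* (:- x) := x :* x) refl x)
    (*-pos 0<-x 0<-x)
    where
    0<-x : 0# < - x
    0<-x = <-respˡ (-‿inverseʳ x) (<-respʳ (+-identityˡ (- x)) (+-monoˡ-< (- x) x<0))

  square-nonneg : ∀ x → ¬ (x * x < 0#)
  square-nonneg x x²<0 with x ≟ 0#
  ... | yes x≈0 = irrefl (trans (*-congʳ x≈0) (zeroˡ x)) x²<0
  ... | no  x≉0 = irrefl refl (<-trans x²<0 (square-pos x≉0))

module ComplexProperties (ℝ : RealField) where
  private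
    module ℝ where
      open RealField ℝ public
      open RealProperties ℝ public
    open ℝ.RingSolver using (solve; _:=_; _:+_; _:*_; _:-_; :-_; con)
  open Complex ℝ

  ≈-isEquivalence : IsEquivalence _≈_
  ≈-isEquivalence = record
    { refl  = ℝ.refl , ℝ.refl
    ; sym   = λ (p , q) → ℝ.sym p , ℝ.sym q
    ; trans = λ (p , q) (p′ , q′) → ℝ.trans p p′ , ℝ.trans q q′
    }

  commutativeRing : CommutativeRing 0ℓ 0ℓ
  commutativeRing = record
    { Carrier = ℂ
    ; _≈_ = _≈_
    ; _+_ = _+_
    ; _*_ = _*_
    ; -_  = -_
    ; 0#  = 0#
    ; 1#  = 1#
    ; isCommutativeRing = record
      { isRing = record
        { +-isAbelianGroup = record
          { isGroup = record
            { isMonoid = record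
              { isSemigroup = record
                { isMagma = record
                  { isEquivalence = ≈-isEquivalence
                  ; ∙-cong = λ (p , q) (p′ , q′) → ℝ.+-cong p p′ , ℝ.+-cong q q′
                  }
                ; assoc = λ (a +i b) (c +i d) (e +i f) → ℝ.+-assoc a c e , ℝ.+-assoc b d f
                }
              ; identity = (λ (a +i b) → ℝ.+-identityˡ a , ℝ.+-identityˡ b)
                         , (λ (a +i b) → ℝ.+-identityʳ a , ℝ.+-identityʳ b)
              }
            ; inverse = (λ (a +i b) → ℝ.-‿inverseˡ a , ℝ.-‿inverseˡ b)
                      , (λ (a +i b) → ℝ.-‿inverseʳ a , ℝ.-‿inverseʳ b)
            ; ⁻¹-cong = λ (p , q) → ℝ.-‿cong p , ℝ.-‿cong q
            }
          ; comm = λ (a +i b) (c +i d) → ℝ.+-comm a c , ℝ.+-comm b d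
          }
        ; *-cong = λ (p , q) (p′ , q′) →
            ℝ.+-cong (ℝ.*-cong p p′) (ℝ.-‿cong (ℝ.*-cong q q′)) ,
            ℝ.+-cong (ℝ.*-cong p q′) (ℝ.*-cong q p′)
        ; *-assoc = λ (a +i b) (c +i d) (e +i f) →
            solve 6 (λ a b c d e f →
              (a :* c :- b :* d) :* e :- (a :* d :+ b :* c) :* f
              := a :* (c :* e :- d :* f) :- b :* (c :* f :+ d :* e)) ℝ.refl a b c d e f ,
            solve 6 (λ a b c d e f →
              (a :* c :- b :* d) :* f :+ (a :* d :+ b :* c) :* e
              := a :* (c :* f :+ d :* e) :+ b :* (c :* e :- d :* f)) ℝ.refl a b c d e f
        ; *-identity =
            (λ (a +i b) →
              solve 2 (λ a b → con (+ 1) :* a :- con (+ 0) :* b := a) ℝ.refl a b ,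
              solve 2 (λ a b → con (+ 1) :* b :+ con (+ 0) :* a := b) ℝ.refl a b) ,
            (λ (a +i b) →
              solve 2 (λ a b → a :* con (+ 1) :- b :* con (+ 0) := a) ℝ.refl a b ,
              solve 2 (λ a b → a :* con (+ 0) :+ b :* con (+ 1) := b) ℝ.refl a b)
        ; distrib =
            (λ (a +i b) (c +i d) (e +i f) →
              solve 6 (λ a b c d e f → a :* (c :+ e) :- b :* (d :+ f)
                := (a :* c :- b :* d) :+ (a :* e :- b :* f)) ℝ.refl a b c d e f ,
              solve 6 (λ a b c d e f → a :* (d :+ f) :+ b :* (c :+ e)
                := (a :* d :+ b :* c) :+ (a :* f :+ b :* e)) ℝ.refl a b c d e f) ,
            (λ (a +i b) (c +i d) (e +i f) →
              solve 6 (λ a b c d e f → (c :+ e) :* a :- (d :+ f) :* b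
                := (c :* a :- d :* b) :+ (e :* a :- f :* b)) ℝ.refl a b c d e f ,
              solve 6 (λ a b c d e f → (c :+ e) :* b :+ (d :+ f) :* a
                := (c :* b :+ d :* a) :+ (e :* b :+ f :* a)) ℝ.refl a b c d e f)
        }
      ; *-comm = λ (a +i b) (c +i d) →
          solve 4 (λ a b c d → a :* c :- b :* d := c :* a :- d :* b) ℝ.refl a b c d ,
          solve 4 (λ a b c d → a :* d :+ b :* c := c :* b :+ d :* a) ℝ.refl a b c d
      }
    }

  open CommutativeRing commutativeRing public
    using ( setoid; refl; sym; trans; +-cong; +-congˡ; +-congʳ; *-cong; *-congˡ; *-congʳ
          ; *-assoc; *-comm; *-identityˡ; *-identityʳ; zeroˡ; zeroʳ; -‿cong; -‿inverseʳ
          ; +-identityˡ; +-commutativeMonoid)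
  open IntegerCoefficients commutativeRing public hiding (fromℤ)

  infix 4 _≟_
  -- Trichotomy decides equality in ℝ, hence in each coordinate. The later case splits on ζ = 1 and
  -- ε(x) = 1 rest on this.
  _≟_ : Decidable _≈_
  (a +i b) ≟ (c +i d) = map′ (λ (p , q) → p , q) (λ (p , q) → p , q)
    ((a ℝ.≟ c) ×-dec (b ℝ.≟ d))

  ∣∣²-pos : ∀ {z} → ¬ z ≈ 0# → ℝ.0# ℝ.< ∣ z ∣²
  ∣∣²-pos {a +i b} z≉0 with a ℝ.≟ ℝ.0#
  ... | no  a≉0 = ℝ.+-pos (ℝ.square-pos a≉0) (ℝ.square-nonneg b)
  ... | yes a≈0 = ℝ.<-respʳ (ℝ.+-comm (b ℝ.* b) (a ℝ.* a))
    (ℝ.+-pos (ℝ.square-pos (λ b≈0 → z≉0 (a≈0 , b≈0))) (ℝ.square-nonneg a))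

  -- `z ⁻¹` is the conjugate of z over |z|²: the imaginary parts cancel and the real part is |z|²
  -- times its inverse.
  *-inverseʳ : ∀ {z} → ¬ z ≈ 0# → z * z ⁻¹ ≈ 1#
  *-inverseʳ {a +i b} z≉0 =
    ℝ.trans (solve 3 (λ a b r → a :* (a :* r) :- b :* (:- (b :* r)) := (a :* a :+ b :* b) :* r)
              ℝ.refl a b (∣ a +i b ∣² ℝ.⁻¹))
            (ℝ.*-inverseʳ (∣∣²-pos z≉0)) ,
    solve 3 (λ a b r → a :* (:- (b :* r)) :+ b :* (a :* r) := con (+ 0))
      ℝ.refl a b (∣ a +i b ∣² ℝ.⁻¹)

  *-cancelˡ-0 : ∀ {z w} → ¬ z ≈ 0# → z * w ≈ 0# → w ≈ 0#
  *-cancelˡ-0 {z} {w} z≉0 zw≈0 = begin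
    w                  ≈⟨ *-identityˡ w ⟨
    1# * w             ≈⟨ *-congʳ (*-inverseʳ z≉0) ⟨
    z * z ⁻¹ * w       ≈⟨ *-congʳ (*-comm z (z ⁻¹)) ⟩
    z ⁻¹ * z * w       ≈⟨ *-assoc (z ⁻¹) z w ⟩
    z ⁻¹ * (z * w)     ≈⟨ *-congˡ zw≈0 ⟩
    z ⁻¹ * 0#          ≈⟨ zeroʳ (z ⁻¹) ⟩
    0#                 ∎
    where open import Relation.Binary.Reasoning.Setoid setoid

-- Roots of unity modulo 𝔭, and triviality of the nebentypus

module _ (ℝ : RealField) where
  open ModularForms ℝ
  open ComplexProperties ℝ
  open SumProperties +-commutativeMonoid using (sum-cong-≋; sum-replicate-zero)
  open RingSolver using (solve; _:=_; _:+_; _:*_; _:-_; :-_; con)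

  -- ζ is a root of X^n - 1, which is monic of degree n for n > 0; for n = 0 the equation would say
  -- nothing about ζ.
  rootOfUnity∈ℤ̄ : ∀ {n ζ} → ¬ n ≡ 0 → ζ ^ n ≈ 1# → ℤ̄ ζ
  rootOfUnity∈ℤ̄ {zero}      n≢0 _    = contradiction ≡.refl n≢0
  rootOfUnity∈ℤ̄ {suc n} {ζ} _   ζⁿ≈1 = suc n , coeff , (begin
    ζ ^ suc n + eval (λ j → fromℤ (coeff j)) ζ
      ≈⟨ +-cong ζⁿ≈1 (+-cong (*-congʳ (-‿cong fromℤ-1))
           (trans (sum-cong-≋ {n} (λ j → zeroˡ _)) (sum-replicate-zero n))) ⟩
    1# + (- 1# * 1# + 0#)
      ≈⟨ solve 0 (con (+ 1) :+ ((:- con (+ 1)) :* con (+ 1) :+ con (+ 0)) := con (+ 0)) refl ⟩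
    0# ∎)
    where
    open import Relation.Binary.Reasoning.Setoid setoid
    coeff : Fin (suc n) → ℤ
    coeff zero    = -[1+ 0 ]
    coeff (suc _) = + 0

  module _ {a : ℕ → ℂ} where

    fromℕ∈ℚ⟨⟩ : ∀ n → ℚ⟨ a ⟩ (fromℕ n)
    fromℕ∈ℚ⟨⟩ zero    = ≈-resp (-‿inverseʳ 1#) (add one (neg one))
    fromℕ∈ℚ⟨⟩ (suc n) = add one (fromℕ∈ℚ⟨⟩ n)

    fromℤ∈ℚ⟨⟩ : ∀ m → ℚ⟨ a ⟩ (fromℤ m)
    fromℤ∈ℚ⟨⟩ (+ n)    = fromℕ∈ℚ⟨⟩ n
    fromℤ∈ℚ⟨⟩ -[1+ n ] = neg (fromℕ∈ℚ⟨⟩ (suc n))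

  module RootsModuloPrime {a : ℕ → ℂ} {p : ℕ} {𝔭 : Pred ℂ 0ℓ}
                          (over-p : IsPrimeOver (𝓞 ℚ⟨ a ⟩) p 𝔭) where
    open IsPrimeOver over-p

    fromℤ∈𝔭 : ∀ m → + p ∣ℤ m → fromℤ m ∈ 𝔭
    fromℤ∈𝔭 m = Equivalence.from (over m)

    0∈𝔭 : 0# ∈ 𝔭
    0∈𝔭 = fromℤ∈𝔭 (+ 0) (ℤ∣.divides (+ 0) ≡.refl)

    -- Otherwise 1 = m + (1 - m) would lie in 𝔭, as p divides 1 - m.
    fromℤ≉0 : ∀ m → m ≡ + 1 [mod p ] → ¬ fromℤ m ≈ 0#
    fromℤ≉0 m m≡1 m≈0 = proper (resp (begin
      fromℤ m + fromℤ (+ 1 ℤ.- m)  ≈⟨ fromℤ-+ m (+ 1 ℤ.- m) ⟨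
      fromℤ (m ℤ.+ (+ 1 ℤ.- m))    ≡⟨ ≡.cong fromℤ (lemma m) ⟩
      fromℤ (+ 1)                  ≈⟨ fromℤ-1 ⟩
      1#                           ∎) (+-closed (resp (sym m≈0) 0∈𝔭)
              (fromℤ∈𝔭 (+ 1 ℤ.- m) (≡[mod]-sym m (+ 1) m≡1))))
      where
      open import Relation.Binary.Reasoning.Setoid setoid
      lemma : ∀ m → m ℤ.+ (+ 1 ℤ.- m) ≡ + 1
      lemma = solve-∀

    module _ {ζ n} (ζⁿ≈1 : ζ ^ n ≈ 1#) (p∤n : ¬ p ∣ n) where

      n≢0 : ¬ n ≡ 0
      n≢0 n≡0 = p∤n (≡.subst (p ∣_) (≡.sym n≡0) (p ∣.∣0))

      module _ (ζ∈ : ζ ∈ ℚ⟨ a ⟩) (ζ-1∈𝔭 : (ζ - 1#) ∈ 𝔭) where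

        ζ∈𝓞 : ζ ∈ 𝓞 ℚ⟨ a ⟩
        ζ∈𝓞 = ζ∈ , rootOfUnity∈ℤ̄ n≢0 ζⁿ≈1

        ζ^-1∈𝔭 : ∀ m → (ζ ^ m - 1#) ∈ 𝔭
        ζ^-1∈𝔭 zero    = resp (sym (-‿inverseʳ 1#)) 0∈𝔭
        ζ^-1∈𝔭 (suc m) = resp
          (solve 2 (λ z t → z :* (t :- con (+ 1)) :+ (z :- con (+ 1)) := z :* t :- con (+ 1))
            refl ζ (ζ ^ m))
          (+-closed (absorb ζ∈𝓞 (ζ^-1∈𝔭 m)) ζ-1∈𝔭)

        -- s is 1 + ζ + ... + ζ^(m-1), each term being congruent to 1 modulo 𝔭. One induction builds
        -- both the congruence s ≡ m and the telescoping identity.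
        geometric : ∀ m → ∃[ s ] (s - fromℕ m) ∈ 𝔭 × (ζ - 1#) * s ≈ ζ ^ m - 1#
        geometric zero =
          0# , resp (sym (-‿inverseʳ 0#)) 0∈𝔭 ,
          trans (zeroʳ _) (sym (-‿inverseʳ 1#))
        geometric (suc m) with geometric m
        ... | s , s-m∈𝔭 , eq = s + ζ ^ m ,
          resp (solve 3 (λ s t m → (s :- m) :+ (t :- con (+ 1)) := (s :+ t) :- (con (+ 1) :+ m))
                 refl s (ζ ^ m) (fromℕ m))
            (+-closed s-m∈𝔭 (ζ^-1∈𝔭 m)) ,
          (begin
          (ζ - 1#) * (s + ζ ^ m)
            ≈⟨ solve 3 (λ z s t → (z :- con (+ 1)) :* (s :+ t) := (z :- con (+ 1)) :* s :+ (z :- con (+ 1)) :* t)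
                 refl ζ s (ζ ^ m) ⟩
          (ζ - 1#) * s + (ζ - 1#) * ζ ^ m
            ≈⟨ +-congʳ eq ⟩
          (ζ ^ m - 1#) + (ζ - 1#) * ζ ^ m
            ≈⟨ solve 2 (λ z t → (t :- con (+ 1)) :+ (z :- con (+ 1)) :* t := z :* t :- con (+ 1))
                 refl ζ (ζ ^ m) ⟩
          ζ ^ suc m - 1# ∎)
          where open import Relation.Binary.Reasoning.Setoid setoid

        -- If ζ ≠ 1, then (ζ - 1)s = ζ^n - 1 = 0 forces s = 0, so -n = s - n lies in 𝔭 and p divides
        -- n.
        ζ≈1 : ζ ≈ 1#
        ζ≈1 with ζ ≟ 1#
        ... | yes ζ≈1 = ζ≈1
        ... | no  ζ≉1 with geometric n
        ...   | s , s-n∈𝔭 , eq = contradiction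
          (∣.∣-trans (ℤ∣.∣⇒∣ᵤ (Equivalence.to (over (ℤ.- + n)) -n∈𝔭))
            (∣.∣-reflexive (ℤ.∣-i∣≡∣i∣ (+ n)))) p∤n
          where
          s≈0 : s ≈ 0#
          s≈0 = *-cancelˡ-0 (λ ζ-1≈0 → ζ≉1 (x∙y⁻¹≈ε⇒x≈y ζ 1# ζ-1≈0))
            (trans eq (trans (+-congʳ ζⁿ≈1) (-‿inverseʳ 1#)))
          -n∈𝔭 : fromℤ (ℤ.- + n) ∈ 𝔭
          -n∈𝔭 = resp (trans (+-congʳ s≈0) (trans (+-identityˡ _) (sym (fromℤ-neg (+ n))))) s-n∈𝔭

      -- Here y stands for the factor x^e in the definition of H. Adding ζ(1 - y), an element of 𝔭,
      -- to ζy - 1 leaves ζ - 1.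
      rootOfUnity≈1 : ∀ y → y ≡ + 1 [mod p ] → (ζ * fromℤ y - 1#) ∈ 𝔭 → ζ ≈ 1#
      rootOfUnity≈1 y y≡1 ζy-1∈𝔭 = ζ≈1 ζ∈ (resp (begin
          (ζ * Y - 1#) + ζ * fromℤ (+ 1 ℤ.- y)
            ≈⟨ +-congˡ (*-congˡ (trans (fromℤ-+ (+ 1) (ℤ.- y)) (+-cong fromℤ-1 (fromℤ-neg y)))) ⟩
          (ζ * Y - 1#) + ζ * (1# - Y)
            ≈⟨ solve 2 (λ z y → (z :* y :- con (+ 1)) :+ z :* (con (+ 1) :- y) := z :- con (+ 1)) refl ζ Y ⟩
          ζ - 1# ∎)
          (+-closed ζy-1∈𝔭 (absorb (ζ∈ , rootOfUnity∈ℤ̄ n≢0 ζⁿ≈1)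
            (fromℤ∈𝔭 (+ 1 ℤ.- y) (≡[mod]-sym y (+ 1) y≡1)))))
        where
        open import Relation.Binary.Reasoning.Setoid setoid
        Y = fromℤ y
        -- ζ is recovered from ζy - 1, which lies in the field as an element of 𝔭, by adding 1 and
        -- dividing by y ≠ 0.
        ζ∈ : ζ ∈ ℚ⟨ a ⟩
        ζ∈ = ≈-resp (begin
          ((ζ * Y - 1#) + 1#) * Y ⁻¹
            ≈⟨ solve 3 (λ z y r → ((z :* y :- con (+ 1)) :+ con (+ 1)) :* r := z :* (y :* r)) refl ζ Y (Y ⁻¹) ⟩
          ζ * (Y * Y ⁻¹)
            ≈⟨ *-congˡ (*-inverseʳ (fromℤ≉0 y y≡1)) ⟩
          ζ * 1#
            ≈⟨ *-identityʳ ζ ⟩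
          ζ ∎)
          (mul (add (proj₁ (subset ζy-1∈𝔭)) one) (inv (fromℤ∈ℚ⟨⟩ y)))

  -- The nebentypus and invariance under Γ₀(N)

  module _ {n ε} (character : IsDirichletCharacter n ε) where
    open IsDirichletCharacter character

    character-^ : ∀ x m → ε (x ℤ.^ m) ≈ ε x ^ m
    character-^ x zero    = 1-homo
    character-^ x (suc m) = trans (*-homo x (x ℤ.^ m)) (*-congˡ (character-^ x m))

    character-^φ : .{{_ : ℕ.NonZero n}} → ∀ {x} → Coprime x n → ε (+ x) ^ φ n ≈ 1#
    character-^φ {x} x⊥n = trans (sym (character-^ (+ x) (φ n)))
      (trans (periodic _ _ (euler n x x⊥n)) 1-homo)

  module _ {k N} (f : NormalizedEigenform k N) where
    open NormalizedEigenform f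

    -- Membership of γ in Γ₀(N) gives x prime to N with d ≡ x, so f ∣ γ = ε(d) f = ε(x) f = f. The
    -- cusp condition runs over all of SL₂(ℤ) and carries over unchanged.
    trivialCharacter⇒Γ₀-cuspForm :
      (∀ {x} → Coprime x N → ε (+ x) ≈ 1#) → IsCuspForm k (Γ₀ N) form
    trivialCharacter⇒Γ₀-cuspForm ε≈1 = record
      { cong        = IsCuspForm.cong cuspForm
      ; holomorphic = IsCuspForm.holomorphic cuspForm
      ; invariant   = λ γ γ∈Γ₀@(_ , _ , x , x⊥N , d≡x) z z∈ℍ →
          trans (diamond γ γ∈Γ₀ z z∈ℍ)
            (trans (*-congʳ (trans (IsDirichletCharacter.periodic character _ _ d≡x) (ε≈1 x⊥N)))
              (*-identityˡ _))
      ; cuspidal    = IsCuspForm.cuspidal cuspForm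
      }

    -- Invariance and the diamond action together give (ε(x) - 1) f = 0 on ℍ, where f is not
    -- identically zero.
    Γ₀-cuspForm⇒trivialCharacter :
      IsCuspForm k (Γ₀ N) form → ∀ {x} → Coprime x N → ε (+ x) ≈ 1#
    Γ₀-cuspForm⇒trivialCharacter cusp {x} x⊥N with ε (+ x) ≟ 1#
    ... | yes ε≈1 = ε≈1
    ... | no  ε≉1 with Γ₀-element x⊥N
    ...   | γ , γ∈Γ₀ , ≡.refl = contradiction (λ z z∈ℍ →
            *-cancelˡ-0 (λ ε-1≈0 → ε≉1 (x∙y⁻¹≈ε⇒x≈y (ε (+ x)) 1# ε-1≈0))
              (begin
              (ε (+ x) - 1#) * form z
                ≈⟨ solve 2 (λ e v → (e :- con (+ 1)) :* v := e :* v :- v) refl (ε (+ x)) (form z) ⟩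
              ε (+ x) * form z - form z
                ≈⟨ +-congʳ (diamond γ γ∈Γ₀ z z∈ℍ) ⟨
              (form ∣[ k ] γ) z - form z
                ≈⟨ +-congʳ (IsCuspForm.invariant cusp γ γ∈Γ₀ z z∈ℍ) ⟩
              form z - form z
                ≈⟨ -‿inverseʳ (form z) ⟩
              0# ∎)) nonzero
      where open import Relation.Binary.Reasoning.Setoid setoid

    -- Comparing Γ_H with Γ₀(Nℓ)

    module _ {ℓ} (ℓ-prime : Prime ℓ) (0<N : 0 ℕ.< N) (N⊥ℓ : Coprime N ℓ)
             {𝔩} (over-ℓ : IsPrimeOver (𝓞 (K f)) ℓ 𝔩)
             (ℓ∤φN : ¬ ℓ ∣ φ N) {e} (ℓ-1∣e : + (ℓ ∸ 1) ∣ℤ e) where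
      private
        instance
          N≢0 : ℕ.NonZero N
          N≢0 = ℕ.>-nonZero 0<N
          ℓ≢0 : ℕ.NonZero ℓ
          ℓ≢0 = prime⇒nonZero ℓ-prime
          Nℓ≢0 : ℕ.NonZero (N ℕ.* ℓ)
          Nℓ≢0 = ℕ.m*n≢0 N ℓ

        H  = CongruenceSubgroup ε 𝔩 N ℓ e
        ΓH = Γ (N ℕ.* ℓ) H

      open IsDirichletCharacter character
      open IsPrimeOver over-ℓ using (resp)
      open RootsModuloPrime over-ℓ using (0∈𝔭; rootOfUnity≈1)

      -- By Fermat x^e ≡ 1 mod ℓ, so membership in H makes ε(x), a φ(N)-th root of unity, congruent
      -- to 1 modulo 𝔩; and ℓ does not divide φ(N).
      ∈H⇒trivial : ∀ {x} → H x → ε (+ x) ≈ 1#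
      ∈H⇒trivial {x} (_ , _ , x⊥Nℓ , y , y≡xᵉ , εy-1∈𝔩) =
        rootOfUnity≈1 (character-^φ character (coprime-∣ʳ (∣.m∣m*n ℓ) x⊥Nℓ)) ℓ∤φN y
          (PowerMod⁻ ℓ-prime (coprime-∣ʳ (∣.n∣m*n N) x⊥Nℓ) e {y} ℓ-1∣e y≡xᵉ) εy-1∈𝔩

      trivial⇒∈H : ∀ {x} → 0 ℕ.< x → x ℕ.< N ℕ.* ℓ → Coprime x (N ℕ.* ℓ) →
                   ε (+ x) ≈ 1# → H x
      -- Representing x^e by 1 turns the condition into 1 · 1 - 1 = 0 ∈ 𝔩.
      trivial⇒∈H {x} 0<x x<Nℓ x⊥Nℓ ε≈1 = 0<x , x<Nℓ , x⊥Nℓ , + 1 ,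
        PowerMod-1 ℓ-prime (coprime-∣ʳ (∣.n∣m*n N) x⊥Nℓ) e ℓ-1∣e ,
        resp (sym (begin
          ε (+ x) * fromℤ (+ 1) - 1#  ≈⟨ +-congʳ (*-cong ε≈1 fromℤ-1) ⟩
          1# * 1# - 1#                ≈⟨ +-congʳ (*-identityˡ 1#) ⟩
          1# - 1#                     ≈⟨ -‿inverseʳ 1# ⟩
          0#                          ∎))
          0∈𝔭
        where open import Relation.Binary.Reasoning.Setoid setoid

      -- A lower right entry in Γ₀(Nℓ) is prime to ℓ as well, so x is first moved within its class
      -- modulo N. The new entry is congruent modulo Nℓ, hence modulo N, to a member of H, where ε
      -- is 1.
      ΓH≐Γ₀⇒trivial : ΓH ≐ Γ₀ (N ℕ.* ℓ) → ∀ {x} → Coprime x N → ε (+ x) ≈ 1#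
      ΓH≐Γ₀⇒trivial (_ , Γ₀⊆ΓH) {x} x⊥N with lift-coprime ℓ-prime N⊥ℓ x x⊥N
      ... | x′ , x′⊥Nℓ , x′≡x with Γ₀-element x′⊥Nℓ
      ...   | γ , γ∈Γ₀ , ≡.refl with Γ₀⊆ΓH {γ} γ∈Γ₀
      ...     | _ , _ , x″ , x″∈H , x′≡x″ = begin
        ε (+ x)   ≈⟨ periodic _ _ x′≡x ⟨
        ε (+ x′)  ≈⟨ periodic _ _ (≡[mod]-∣ (+ x′) (+ x″) (∣.m∣m*n ℓ) x′≡x″) ⟩
        ε (+ x″)  ≈⟨ ∈H⇒trivial x″∈H ⟩
        1#        ∎
        where open import Relation.Binary.Reasoning.Setoid setoid

      trivial⇒ΓH≐Γ₀ : (∀ {x} → Coprime x N → ε (+ x) ≈ 1#) → ΓH ≐ Γ₀ (N ℕ.* ℓ)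
      trivial⇒ΓH≐Γ₀ ε≈1 =
        (λ (det≡1 , c≡0 , x , (_ , _ , x⊥Nℓ , _) , d≡x) → det≡1 , c≡0 , x , x⊥Nℓ , d≡x) ,
        (λ {γ} (det≡1 , c≡0 , x , x⊥Nℓ , d≡x) →
          -- H contains only representatives strictly between 0 and Nℓ, so x is replaced by its
          -- residue r.
          let r = + x %ℕ (N ℕ.* ℓ)
              x≡r = ≡[mod]-sym (+ r) (+ x) (%ℕ-≡[mod] (+ x))
              r⊥Nℓ = coprime-≡[mod] (+ x) (+ r) x≡r x⊥Nℓ
          in det≡1 , c≡0 , r ,
             trivial⇒∈H (0<unit r⊥Nℓ) (n%ℕd<d (+ x) (N ℕ.* ℓ)) r⊥Nℓ
               (ε≈1 (coprime-∣ʳ (∣.m∣m*n ℓ) r⊥Nℓ)) ,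
             ≡[mod]-trans (M₂.d γ) (+ x) (+ r) d≡x x≡r)
        where
        0<unit : ∀ {r} → Coprime r (N ℕ.* ℓ) → 0 ℕ.< r
        -- If 0 were prime to Nℓ, then Nℓ = 1, yet the prime ℓ divides Nℓ.
        0<unit {zero}  0⊥Nℓ = ⊥-elim (ℕ.nonTrivial⇒≢1 {{prime⇒nonTrivial ℓ-prime}}
          (∣.∣1⇒≡1 (≡.subst (ℓ ∣_) (Coprime.0-coprimeTo-m⇒m≡1 0⊥Nℓ) (∣.n∣m*n N))))
        0<unit {suc r} _ = ℕ.z<s

theorem5p5 :
    (ℝ : RealField) (ℓ : ℕ) → Prime ℓ → 5 ℕ.≤ ℓ →
    (F : HeytingField 0ℓ 0ℓ 0ℓ) → IsAlgebraicClosureOf𝔽 ℓ F →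
    let open ModularForms ℝ
        open Representations ℝ F
    in
    (N k : ℕ) → 0 ℕ.< N → Coprime N ℓ → 2 ℕ.< k →
    (f : NormalizedEigenform k N) →
    let open NormalizedEigenform in
    (𝔩 : Pred ℂ 0ℓ) → IsPrimeOver (𝓞 (K f)) ℓ 𝔩 →
    (ι : ResidueEmbedding (𝓞 (K f)) 𝔩) →
    (ρ : Representation) → IsAttached f ℓ ι ρ →
    Irreducible ρ →
    (i : ℕ) → i ℕ.≤ ℓ ∸ 1 →
    let e  = + k ℤ.- + 2 ℤ.- + 2 ℤ.* + i
        H  = CongruenceSubgroup (ε f) 𝔩 N ℓ e
        ΓH = Γ (N ℕ.* ℓ) H
    in
    (Σ[ f₂ ∈ NormalizedEigenform 2 (N ℕ.* ℓ) ]
       IsCuspForm 2 ΓH (form f₂) ×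
       (∃[ 𝔩₂ ] IsPrimeOver (𝓞 (K f₂)) ℓ 𝔩₂ ×
         (Σ[ ι₂ ∈ ResidueEmbedding (𝓞 (K f₂)) 𝔩₂ ]
          ∃[ ρ₂ ] ∃[ χ ] IsAttached f₂ ℓ ι₂ ρ₂ × IsCyclotomic ℓ χ ×
            mapρ ρ ≅ (mapρ ρ₂ ⊗ χ ^ i)))) →
    ¬ (ℓ ∣ φ N) →
    (+ (ℓ ∸ 1)) ∣ℤ e →
    ΓH ≐ Γ₀ (N ℕ.* ℓ) ⇔ IsCuspForm k (Γ₀ N) (form f)
theorem5p5 ℝ ℓ ℓ-prime _ _ _ N k 0<N N⊥ℓ _ f 𝔩 over-ℓ _ _ _ _ i _ _ ℓ∤φN ℓ-1∣e = mk⇔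
  (λ ΓH≐Γ₀ → trivialCharacter⇒Γ₀-cuspForm ℝ f
    (ΓH≐Γ₀⇒trivial ℝ f ℓ-prime 0<N N⊥ℓ over-ℓ ℓ∤φN ℓ-1∣e ΓH≐Γ₀))
  (λ cusp → trivial⇒ΓH≐Γ₀ ℝ f ℓ-prime 0<N N⊥ℓ over-ℓ ℓ∤φN ℓ-1∣e
    (Γ₀-cuspForm⇒trivialCharacter ℝ f cusp))
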